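{- Let $n\ge1$ and fix a permutation $\eta=(\eta_1,\dots,\eta_n)$ of $\{1,\dots,n\}$; put $P_\eta=\{(1,\eta_1),\dots,(n,\eta_n)\}$. Let $\mathcal C$ be the set of complete non-ambiguous forests (with $n$ leaves) whose set of leaves is $P_\eta$. Let $\mathcal P$ be the set of pairs $(\alpha,\beta)$, $\alpha=(a_1,\dots,a_n)$, $\beta=(b_1,\dots,b_n)$ permutations of $\{1,\dots,n\}$, with no common rise and with $\{(a_1,b_1),\dots,(a_n,b_n)\}=P_\eta$. Then there exists a bijection between $\mathcal C$ and $\mathcal P$; in particular $|\mathcal C|=|\mathcal P|$.
   Context: A non-ambiguous forest is a finite set $A\subseteq\mathbb N^+\times\mathbb N^+$ of points $p=(x(p),y(p))$ such that: (i) if some point has first coordinate $x$ then every $1\le x'<x$ is the first coordinate of some point, and likewise for second coordinates; (ii) there is no $p\in A$ for which there exist both $q\in A$ with $x(q)=x(p)$, $y(q)<y(p)$ and $s\in A$ with $y(s)=y(p)$, $x(s)<x(p)$. Its forest structure: the parent of $p$ is the point $q\in A$ with $x(q)=x(p)$, $y(q)<y(p)$ and $y(q)$ maximal if one exists, otherwise the point $s\in A$ with $y(s)=y(p)$, $x(s)<x(p)$ and $x(s)$ maximal if one exists, otherwise $p$ is a root. Leaves are points with no children; the forest is complete if every point has $0$ or $2$ children. The pair $(\alpha,\beta)$ has a common rise at $i$ ($1\le i\le n-1$) if $a_i<a_{i+1}$ and $b_i<b_{i+1}$. -}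

module Defs where

open import Data.Nat using (ℕ; suc; _<_; _≤_)
open import Data.Product using (_×_; _,_; proj₁; proj₂; ∃; ∃-syntax; Σ)
open import Data.Sum using (_⊎_)
open import Data.List using (List; map; upTo; zip)
open import Data.Vec using (Vec; toList; lookup)
open import Data.Fin using (Fin; toℕ)
open import Data.List.Membership.Propositional using (_∈_)
open import Data.List.Relation.Unary.Linked using (Linked)
open import Data.List.Relation.Binary.Permutation.Propositional using (_↭_)
open import Relation.Binary.PropositionalEquality using (_≡_; _≢_)
open import Relation.Nullary using (¬_)
open import Function.Bundles using (_⇔_)

Point : Set
Point = ℕ × ℕ

x : Point → ℕ
x = proj₁

y : Point → ℕ
y = proj₂

-- strict lexicographic order; strictly sorted lists are canonical
-- representatives of finite sets of points
_<ₚ_ : Point → Point → Set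
p <ₚ q = (x p < x q) ⊎ (x p ≡ x q × y p < y q)

IsPerm : (n : ℕ) → Vec ℕ n → Set
IsPerm n v = toList v ↭ map suc (upTo n)

graphPts : (n : ℕ) → Vec ℕ n → List Point
graphPts n v = zip (map suc (upTo n)) (toList v)

pairPts : (n : ℕ) → Vec ℕ n → Vec ℕ n → List Point
pairPts n a b = zip (toList a) (toList b)

module _ (A : List Point) where

  PositiveCoords : Set
  PositiveCoords = ∀ p → p ∈ A → 1 ≤ x p × 1 ≤ y p

  NoGaps : Set
  NoGaps = ∀ p → p ∈ A →
             (∀ x' → 1 ≤ x' → x' < x p → ∃[ q ] (q ∈ A × x q ≡ x'))
           × (∀ y' → 1 ≤ y' → y' < y p → ∃[ q ] (q ∈ A × y q ≡ y'))

  Below : Point → Point → Set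
  Below q p = q ∈ A × x q ≡ x p × y q < y p

  LeftOf : Point → Point → Set
  LeftOf s p = s ∈ A × y s ≡ y p × x s < x p

  NonAmbiguous : Set
  NonAmbiguous = ¬ (∃[ p ] (p ∈ A × ∃[ q ] Below q p × ∃[ s ] LeftOf s p))

  IsParent : Point → Point → Set
  IsParent q p =
      (Below q p × (∀ q' → Below q' p → y q' ≤ y q))
    ⊎ ((∀ q' → ¬ Below q' p) × LeftOf q p × (∀ s' → LeftOf s' p → x s' ≤ x q))

  IsLeaf : Point → Set
  IsLeaf p = p ∈ A × (∀ c → c ∈ A → ¬ IsParent p c)

  Complete : Set
  Complete = ∀ p → p ∈ A →
      (∀ c → c ∈ A → ¬ IsParent p c)
    ⊎ (∃[ c₁ ] ∃[ c₂ ] (c₁ ∈ A × IsParent p c₁ × c₂ ∈ A × IsParent p c₂ × c₁ ≢ c₂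
         × (∀ c → c ∈ A → IsParent p c → c ≡ c₁ ⊎ c ≡ c₂)))

-- 𝒞: complete non-ambiguous forests whose set of leaves is P_η.
-- The point set is a strictly sorted list (canonical for the set).
record CForest (n : ℕ) (η : Vec ℕ n) : Set where
  field
    pts        : List Point
    .sorted    : Linked _<ₚ_ pts
    .positive  : PositiveCoords pts
    .noGaps    : NoGaps pts
    .nonAmb    : NonAmbiguous pts
    .complete  : Complete pts
    .leaves    : ∀ p → IsLeaf pts p ⇔ p ∈ graphPts n η

record PermPair (n : ℕ) (η : Vec ℕ n) : Set where
  field
    α          : Vec ℕ n
    β          : Vec ℕ n
    .αPerm     : IsPerm n α
    .βPerm     : IsPerm n β
    .noCommonRise : ∀ (i j : Fin n) → toℕ j ≡ suc (toℕ i) →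
        ¬ (lookup α i < lookup α j × lookup β i < lookup β j)
    .pointSet  : ∀ p → p ∈ pairPts n α β ⇔ p ∈ graphPts n η

{-# OPTIONS --safe #-}
module Submission where

-- In a complete non-ambiguous forest the leaves are exactly the last points of the columns
-- and of the rows, and a forest is a set of binary trees on disjoint sets of rows and columns.
-- A branching point lies at (mx l , my r), where l is its upper and r its right subtree and
-- mx, my are the least coordinates of a tree.  So a tree with leaf set S is either a leaf or a
-- splitting S = S₁ ⊔ S₂ with the x-minimum of S in S₁ and its y-minimum in S₂, together with
-- trees on S₁ and S₂.
--
-- Let wˣ (wʸ) be a word without common rises starting with its x-minimum (y-minimum).
-- Cutting wˣ in front of its y-minimum, or wʸ in front of its x-minimum, leaves one factor of
-- each kind; conversely, such factors concatenate in both orders without creating a rise,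
-- since the second one starts with a minimum of the whole.  Both kinds of words thus obey the
-- recursion of trees.  Finally, any word without common rises factors at its left-to-right
-- minima of x into words of the first kind, which matches the forest with its set of trees.

open import Defs
open import Data.Fin using (Fin; toℕ) renaming (zero to 0F; suc to sucF)
open import Data.List using (List; []; _∷_; [_]; _++_; map; concatMap; length; upTo; zip; filter; deduplicate)
open import Data.List.Membership.DecPropositional using () renaming (_∈?_ to member?; _∉?_ to nonmember?)
open import Data.List.Membership.Propositional using (_∈_; _∉_; find; lose)
open import Data.List.Membership.Propositional.Properties using (∈-++⁺ˡ; ∈-++⁺ʳ; ∈-++⁻; ∈-∃++; ∈-concatMap⁺; ∈-concatMap⁻; ∈-map⁺; ∈-map⁻; ∈-filter⁺; ∈-filter⁻; ∈-deduplicate⁺; ∈-deduplicate⁻; ∈-upTo⁺; ∈-upTo⁻)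
open import Data.List.Membership.Propositional.Properties.WithK using (unique∧set⇒bag)
import Data.List.Properties as List
open import Data.List.Relation.Binary.BagAndSetEquality using (∼bag⇒↭)
open import Data.List.Relation.Binary.Permutation.Propositional using (_↭_; refl; prep; swap; trans; ↭-refl; ↭-sym; ↭-trans; ↭-reflexive)
open import Data.List.Relation.Binary.Permutation.Propositional.Properties using (All-resp-↭; Any-resp-↭; ∈-resp-↭; ++⁺; ++-comm; shift; ↭-length) renaming (map⁺ to ↭-map⁺)
open import Data.List.Relation.Unary.All as All using (All; []; _∷_)
import Data.List.Relation.Unary.All.Properties as All
open import Data.List.Relation.Unary.AllPairs as AllPairs using (AllPairs; []; _∷_; allPairs?)
import Data.List.Relation.Unary.AllPairs.Properties as AllPairs
open import Data.List.Relation.Unary.Any as Any using (Any; here; there)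
open import Data.List.Relation.Unary.Linked as Linked using (Linked; []; [-]; _∷_; linked?)
open import Data.List.Relation.Unary.Linked.Properties using (AllPairs⇒Linked; Linked⇒AllPairs)
open import Data.List.Relation.Unary.Unique.DecPropositional.Properties using (deduplicate-!)
open import Data.List.Relation.Unary.Unique.Propositional using (Unique)
import Data.List.Relation.Unary.Unique.Propositional.Properties as Unique
open import Data.Nat using (ℕ; suc; _+_; _≤_; _<_; z≤n; s≤s; s≤s⁻¹; _≟_; _<?_; _≤?_)
open import Data.Nat.Properties using (≤-refl; ≤-reflexive; ≤-trans; <-trans; <-≤-trans; ≤-<-trans; <⇒≤; <-irrefl; <-asym; <-cmp; ≤⇒≯; ≮⇒≥; ≰⇒≥; ≤-antisym; m≤n+m; m≤m+n; suc-injective; +-suc)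
open import Data.Product using (_×_; _,_; proj₁; proj₂; ∃₂; ∃-syntax)
open import Data.Product.Properties using () renaming (≡-dec to ×-≡-dec)
open import Data.Sum as Sum using (_⊎_; inj₁; inj₂)
open import Data.Unit using (⊤; tt)
open import Data.Vec using (Vec; []; _∷_; toList; fromList; cast; lookup)
import Data.Vec.Properties as Vec
open import Function using (_∘_)
open import Function.Bundles using (_⤖_; _⇔_; mk⇔; mk⤖; Equivalence)
open import Function.Consequences.Propositional using (strictlySurjective⇒surjective)
open import Function.Properties.Bijection using (sym-≡) renaming (trans to ⤖-trans)
open import Level using (0ℓ)
open import Relation.Binary using (Rel; Symmetric; Transitive; Asymmetric; Decidable; tri<; tri≈; tri>)
open import Relation.Binary.PropositionalEquality using (_≡_; _≢_; refl; sym; ≢-sym; cong; cong₂; subst) renaming (trans to ≡-trans)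
open import Relation.Nullary using (¬_; Dec; yes; no; ¬?; contradiction)
open import Relation.Nullary.Decidable using (_×-dec_; _⊎-dec_; recompute)

-- Lists

module _ {A : Set} {R : Rel A 0ℓ} where

  AllPairs-++⁻ : ∀ as {bs} → AllPairs R (as ++ bs) →
                 AllPairs R as × AllPairs R bs × All (λ a → All (R a) bs) as
  AllPairs-++⁻ []       rs       = [] , rs , []
  AllPairs-++⁻ (a ∷ as) (r ∷ rs) =
    let r₁ , r₂ = All.++⁻ as r
        p , q , s = AllPairs-++⁻ as rs
    in (r₁ ∷ p) , q , (r₂ ∷ s)

  AllPairs-resp-↭ : Symmetric R → ∀ {as bs} → as ↭ bs → AllPairs R as → AllPairs R bs
  AllPairs-resp-↭ symR refl         rs       = rs
  AllPairs-resp-↭ symR (prep a σ)   (r ∷ rs) = All-resp-↭ σ r ∷ AllPairs-resp-↭ symR σ rs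
  AllPairs-resp-↭ symR (swap a b σ) ((ab ∷ r) ∷ s ∷ rs) =
    (symR ab ∷ All-resp-↭ σ s) ∷ All-resp-↭ σ r ∷ AllPairs-resp-↭ symR σ rs
  AllPairs-resp-↭ symR (trans σ τ)  rs       = AllPairs-resp-↭ symR τ (AllPairs-resp-↭ symR σ rs)

  Linked-++⁻ : ∀ as {bs} → Linked R (as ++ bs) → Linked R as × Linked R bs
  Linked-++⁻ []           l       = [] , l
  Linked-++⁻ (a ∷ [])     l       = [-] , Linked.tail l
  Linked-++⁻ (a ∷ b ∷ as) (r ∷ l) = let p , q = Linked-++⁻ (b ∷ as) l in r ∷ p , q

  -- The relation to `h` is asked of every entry of `as` and not just of the last, since in each use
  -- `h` is smaller in one coordinate than all of `as`.
  Linked-++⁺ : ∀ {as h bs} → Linked R as → All (λ a → R a h) as →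
               Linked R (h ∷ bs) → Linked R (as ++ h ∷ bs)
  Linked-++⁺ []       []       m = m
  Linked-++⁺ [-]      (r ∷ []) m = r ∷ m
  Linked-++⁺ (s ∷ l)  (_ ∷ rs) m = s ∷ Linked-++⁺ l rs m

  private
    heads-≡ : Asymmetric R → ∀ {a as b bs} → All (R a) as → All (R b) bs →
              a ∈ b ∷ bs → b ∈ a ∷ as → a ≡ b
    heads-≡ asym r s (here e)  _         = e
    heads-≡ asym r s (there _) (here e)  = sym e
    heads-≡ asym r s (there i) (there j) = contradiction (All.lookup s i) (asym (All.lookup r j))

    ∈-tail : Asymmetric R → ∀ {a as bs c} → All (R a) as → c ∈ as → c ∈ a ∷ bs → c ∈ bs
    ∈-tail asym r i (here refl) = contradiction (All.lookup r i) (asym (All.lookup r i))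
    ∈-tail asym r i (there j)   = j

  -- If each head lay in the tail of the other list, each would precede the other. So the heads
  -- agree, and by asymmetry they do not recur in the tails.
  strictlySorted-unique : Asymmetric R → ∀ {as bs} → AllPairs R as → AllPairs R bs →
                          (∀ {c} → c ∈ as → c ∈ bs) → (∀ {c} → c ∈ bs → c ∈ as) → as ≡ bs
  strictlySorted-unique asym {[]}     {[]}     _ _ _ _ = refl
  strictlySorted-unique asym {[]}     {b ∷ bs} _ _ _ g = contradiction (g (here refl)) λ ()
  strictlySorted-unique asym {a ∷ as} {[]}     _ _ f _ = contradiction (f (here refl)) λ ()
  strictlySorted-unique asym {a ∷ as} {b ∷ bs} (r ∷ rs) (s ∷ ss) f g
    with refl ← heads-≡ asym r s (f (here refl)) (g (here refl)) =
    cong (a ∷_) (strictlySorted-unique asym rs ss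
      (λ i → ∈-tail asym r i (f (there i))) (λ i → ∈-tail asym s i (g (there i))))

module InsertionSort {A : Set} {R : Rel A 0ℓ} (R? : Decidable R) (R-trans : Transitive R) where

  insert : A → List A → List A
  insert a []       = [ a ]
  insert a (b ∷ bs) with R? a b
  ... | yes _ = a ∷ b ∷ bs
  ... | no  _ = b ∷ insert a bs

  sort : List A → List A
  sort []       = []
  sort (a ∷ as) = insert a (sort as)

  insert-↭ : ∀ a bs → insert a bs ↭ a ∷ bs
  insert-↭ a []       = ↭-refl
  insert-↭ a (b ∷ bs) with R? a b
  ... | yes _ = ↭-refl
  ... | no  _ = ↭-trans (prep b (insert-↭ a bs)) (swap b a ↭-refl)

  sort-↭ : ∀ as → sort as ↭ as
  sort-↭ []       = ↭-refl
  sort-↭ (a ∷ as) = ↭-trans (insert-↭ a (sort as)) (prep a (sort-↭ as))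

  Comparable : Rel A 0ℓ
  Comparable a b = R a b ⊎ R b a

  insert-sorted : ∀ {a bs} → All (Comparable a) bs → AllPairs R bs → AllPairs R (insert a bs)
  insert-sorted {a} []       []       = [] ∷ []
  insert-sorted {a} {b ∷ bs} (c ∷ cs) (r ∷ rs) with R? a b | c
  ... | yes ab | _       = (ab ∷ All.map (R-trans ab) r) ∷ r ∷ rs
  ... | no ¬ab | inj₁ ab = contradiction ab ¬ab
  ... | no ¬ab | inj₂ ba = All-resp-↭ (↭-sym (insert-↭ a bs)) (ba ∷ r) ∷ insert-sorted cs rs

  -- Comparability is asked only among the entries: `_≺_` sees a tree only through `mx`, so it is
  -- not total on all trees.
  sort-sorted : ∀ {as} → AllPairs Comparable as → AllPairs R (sort as)
  sort-sorted []                  = []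
  sort-sorted {a ∷ as} (c ∷ cs) =
    insert-sorted (All-resp-↭ (↭-sym (sort-↭ as)) c) (sort-sorted cs)

-- Trees

data Tree : Set where
  leaf : Point → Tree
  node : Tree → Tree → Tree

-- Branching points carry no data: the abscissa is found along left children, the ordinate along
-- right ones. Once the tree is `Valid`, these are its least coordinates, by `root-min`.
mx my : Tree → ℕ
mx (leaf p)   = x p
mx (node l r) = mx l
my (leaf p)   = y p
my (node l r) = my r

root : Tree → Point
root t = mx t , my t

-- The inequalities say that `root r` lies strictly to the right of the branching point, in its row,
-- and `root l` strictly above it, in its column.
Valid : Tree → Set
Valid (leaf p)   = ⊤
Valid (node l r) = Valid l × Valid r × mx l < mx r × my r < my l

treeLeaves treePts : Tree → List Point
treeLeaves (leaf p)   = [ p ]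
treeLeaves (node l r) = treeLeaves l ++ treeLeaves r
treePts (leaf p)      = [ p ]
treePts (node l r)    = root (node l r) ∷ treePts l ++ treePts r

forestLeaves : List Tree → List Point
forestLeaves = concatMap treeLeaves

_≺_ : Tree → Tree → Set
s ≺ t = mx s < mx t

_≟ₚ_ : (p q : Point) → Dec (p ≡ q)
_≟ₚ_ = ×-≡-dec _≟_ _≟_

_≟ₜ_ : (s t : Tree) → Dec (s ≡ t)
leaf p   ≟ₜ leaf q with p ≟ₚ q
... | yes refl = yes refl
... | no p≢q   = no λ { refl → p≢q refl }
leaf _   ≟ₜ node _ _ = no λ ()
node _ _ ≟ₜ leaf _   = no λ ()
node l r ≟ₜ node l′ r′ with l ≟ₜ l′ | r ≟ₜ r′
... | yes refl | yes refl = yes refl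
... | no l≢l′  | _        = no λ { refl → l≢l′ refl }
... | _        | no r≢r′  = no λ { refl → r≢r′ refl }

leaf⊆pts : ∀ t {p} → p ∈ treeLeaves t → p ∈ treePts t
leaf⊆pts (leaf _)   i = i
leaf⊆pts (node l r) i with ∈-++⁻ (treeLeaves l) i
... | inj₁ j = there (∈-++⁺ˡ (leaf⊆pts l j))
... | inj₂ j = there (∈-++⁺ʳ (treePts l) (leaf⊆pts r j))

root∈ : ∀ t → root t ∈ treePts t
root∈ (leaf _)   = here refl
root∈ (node _ _) = here refl

data PtsNode (l r : Tree) (p : Point) : Set where
  at-root  : p ≡ root (node l r) → PtsNode l r p
  in-left  : p ∈ treePts l → PtsNode l r p
  in-right : p ∈ treePts r → PtsNode l r p

pts-node⁻ : ∀ l r {p} → p ∈ treePts (node l r) → PtsNode l r p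
pts-node⁻ l r (here e)  = at-root e
pts-node⁻ l r (there i) with ∈-++⁻ (treePts l) i
... | inj₁ j = in-left j
... | inj₂ j = in-right j

pts-left : ∀ l r {p} → p ∈ treePts l → p ∈ treePts (node l r)
pts-left l r i = there (∈-++⁺ˡ i)

pts-right : ∀ l r {p} → p ∈ treePts r → p ∈ treePts (node l r)
pts-right l r i = there (∈-++⁺ʳ (treePts l) i)

root-min : ∀ t → Valid t → ∀ {p} → p ∈ treePts t → mx t ≤ x p × my t ≤ y p
root-min (leaf _)   _                 (here refl) = ≤-refl , ≤-refl
root-min (node l r) (vl , vr , lt , gt) i with pts-node⁻ l r i
... | at-root refl = ≤-refl , ≤-refl
... | in-left j    = let a , b = root-min l vl j in a , ≤-trans (<⇒≤ gt) b
... | in-right j   = let a , b = root-min r vr j in ≤-trans (<⇒≤ lt) a , b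

leaves-min : ∀ t → Valid t → All (λ p → mx t ≤ x p × my t ≤ y p) (treeLeaves t)
leaves-min t v = All.tabulate (root-min t v ∘ leaf⊆pts t)

mx-leaf : ∀ t → ∃[ v ] (v ∈ treeLeaves t × x v ≡ mx t)
mx-leaf (leaf p)   = p , here refl , refl
mx-leaf (node l r) = let v , i , e = mx-leaf l in v , ∈-++⁺ˡ i , e

my-leaf : ∀ t → ∃[ v ] (v ∈ treeLeaves t × y v ≡ my t)
my-leaf (leaf p)   = p , here refl , refl
my-leaf (node l r) = let v , i , e = my-leaf r in v , ∈-++⁺ʳ (treeLeaves l) i , e

-- Words without common rises

NoRise : Rel Point 0ℓ
NoRise p q = ¬ (x p < x q × y p < y q)

wordˣ wordʸ : Tree → List Point
wordˣ (leaf p)   = [ p ]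
wordˣ (node l r) = wordˣ l ++ wordʸ r
wordʸ (leaf p)   = [ p ]
wordʸ (node l r) = wordʸ r ++ wordˣ l

-- Trees will be listed by increasing `mx` and are read backwards, so that each factor starts at a
-- new left-to-right minimum of `x`.
word : List Tree → List Point
word []       = []
word (t ∷ ts) = word ts ++ wordˣ t

wordˣ-↭ : ∀ t → wordˣ t ↭ treeLeaves t
wordʸ-↭ : ∀ t → wordʸ t ↭ treeLeaves t
wordˣ-↭ (leaf _)   = ↭-refl
wordˣ-↭ (node l r) = ++⁺ (wordˣ-↭ l) (wordʸ-↭ r)
wordʸ-↭ (leaf _)   = ↭-refl
wordʸ-↭ (node l r) = ↭-trans (++-comm (wordʸ r) (wordˣ l)) (++⁺ (wordˣ-↭ l) (wordʸ-↭ r))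

word-↭ : ∀ ts → word ts ↭ forestLeaves ts
word-↭ []       = ↭-refl
word-↭ (t ∷ ts) = ↭-trans (++-comm (word ts) (wordˣ t)) (++⁺ (wordˣ-↭ t) (word-↭ ts))

wordˣ-head : ∀ t → ∃₂ λ h w → wordˣ t ≡ h ∷ w × x h ≡ mx t
wordˣ-head (leaf p)   = p , [] , refl , refl
wordˣ-head (node l r) = let h , w , e , f = wordˣ-head l in h , w ++ wordʸ r , cong (_++ wordʸ r) e , f

wordʸ-head : ∀ t → ∃₂ λ h w → wordʸ t ≡ h ∷ w × y h ≡ my t
wordʸ-head (leaf p)   = p , [] , refl , refl
wordʸ-head (node l r) = let h , w , e , f = wordʸ-head r in h , w ++ wordˣ l , cong (_++ wordˣ l) e , f

wordˣ-min : ∀ t → Valid t → All (λ p → mx t ≤ x p × my t ≤ y p) (wordˣ t)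
wordˣ-min t v = All-resp-↭ (↭-sym (wordˣ-↭ t)) (leaves-min t v)

wordʸ-min : ∀ t → Valid t → All (λ p → mx t ≤ x p × my t ≤ y p) (wordʸ t)
wordʸ-min t v = All-resp-↭ (↭-sym (wordʸ-↭ t)) (leaves-min t v)

word-min : ∀ t {ts} → All Valid ts → All (t ≺_) ts → All (λ p → mx t < x p) (word ts)
word-min t []       []       = []
word-min t {s ∷ ts} (v ∷ vs) (m ∷ ms) =
  All.++⁺ (word-min t vs ms) (All.map (<-≤-trans m ∘ proj₁) (wordˣ-min s v))

wordˣ-noRise : ∀ t → Valid t → Linked NoRise (wordˣ t)
wordʸ-noRise : ∀ t → Valid t → Linked NoRise (wordʸ t)
wordˣ-noRise (leaf _)   _ = [-]
wordˣ-noRise (node l r) (vl , vr , lt , gt)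
  with h , w , e , f ← wordʸ-head r | lk ← wordʸ-noRise r vr rewrite e =
  Linked-++⁺ (wordˣ-noRise l vl)
    (All.map (λ (_ , b) (_ , c) → <-asym c (≤-<-trans (≤-reflexive f) (<-≤-trans gt b))) (wordˣ-min l vl)) lk
wordʸ-noRise (leaf _)   _ = [-]
wordʸ-noRise (node l r) (vl , vr , lt , gt)
  with h , w , e , f ← wordˣ-head l | lk ← wordˣ-noRise l vl rewrite e =
  Linked-++⁺ (wordʸ-noRise r vr)
    (All.map (λ (a , _) (c , _) → <-asym c (≤-<-trans (≤-reflexive f) (<-≤-trans lt a))) (wordʸ-min r vr)) lk

word-noRise : ∀ {ts} → All Valid ts → AllPairs _≺_ ts → Linked NoRise (word ts)
word-noRise []       []       = []
word-noRise {t ∷ ts} (v ∷ vs) (m ∷ ms)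
  with h , w , e , f ← wordˣ-head t | lk ← wordˣ-noRise t v rewrite e =
  Linked-++⁺ (word-noRise vs ms)
    (All.map (λ b (c , _) → <-asym c (≤-<-trans (≤-reflexive f) b)) (word-min t vs m)) lk

-- Uniqueness of factorisations at minima.

record MinSplit (f : Point → ℕ) (u : List Point) (b : Point) (v : List Point) : Set where
  constructor minSplit
  field
    before : All (λ q → f b < f q) u
    after  : All (λ q → f b ≤ f q) v

-- Strict inequality before `b` and weak inequality after it make `b` the first minimum of `f`, a
-- position that the word alone determines.
minSplit-unique : ∀ {f} u u′ {b b′ v v′} → MinSplit f u b v → MinSplit f u′ b′ v′ →
                  u ++ b ∷ v ≡ u′ ++ b′ ∷ v′ → u ≡ u′ × b ∷ v ≡ b′ ∷ v′
minSplit-unique []      []       _ _ e = refl , e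
minSplit-unique []      (c ∷ u′) (minSplit _ as) (minSplit (lt ∷ _) _) refl =
  contradiction lt (≤⇒≯ (All.lookup as (∈-++⁺ʳ u′ (here refl))))
minSplit-unique (c ∷ u) []       (minSplit (lt ∷ _) _) (minSplit _ as) refl =
  contradiction lt (≤⇒≯ (All.lookup as (∈-++⁺ʳ u (here refl))))
minSplit-unique (c ∷ u) (c′ ∷ u′) (minSplit (_ ∷ bs) as) (minSplit (_ ∷ bs′) as′) e
  with refl ← List.∷-injectiveˡ e
  with refl , e′ ← minSplit-unique u u′ (minSplit bs as) (minSplit bs′ as′) (List.∷-injectiveʳ e) = refl , e′

-- Restates `minSplit-unique` for a second factor whose head is known only through an equation, the
-- form in which `wordˣ-head` and `wordʸ-head` supply it.
++-split-unique : ∀ (f : Point → ℕ) {u u′ w w′ h h′ v v′ m m′} →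
  w ≡ h ∷ v → f h ≡ m → All (λ p → m < f p) u → All (λ p → m ≤ f p) w →
  w′ ≡ h′ ∷ v′ → f h′ ≡ m′ → All (λ p → m′ < f p) u′ → All (λ p → m′ ≤ f p) w′ →
  u ++ w ≡ u′ ++ w′ → u ≡ u′ × w ≡ w′
++-split-unique f {u} {u′} refl refl bs (_ ∷ as) refl refl bs′ (_ ∷ as′) =
  minSplit-unique u u′ (minSplit bs as) (minSplit bs′ as′)

wordˣ-node≢ : ∀ l r {p} → wordˣ (node l r) ≢ [ p ]
wordˣ-node≢ l r eq
  with h , w , e , _ ← wordˣ-head l | h′ , w′ , e′ , _ ← wordʸ-head r rewrite e | e′
  with () ← List.++-conicalʳ w _ (List.∷-injectiveʳ eq)

wordʸ-node≢ : ∀ l r {p} → wordʸ (node l r) ≢ [ p ]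
wordʸ-node≢ l r eq
  with h , w , e , _ ← wordʸ-head r | h′ , w′ , e′ , _ ← wordˣ-head l rewrite e | e′
  with () ← List.++-conicalʳ w _ (List.∷-injectiveʳ eq)

-- The factors of a node's `wordˣ` meet at the first minimum of `y`, those of its `wordʸ` at the
-- first minimum of `x`, so the word fixes both factors. Leaves and nodes differ in the length of
-- their words.
wordˣ-injective : ∀ t t′ → Valid t → Valid t′ → wordˣ t ≡ wordˣ t′ → t ≡ t′
wordʸ-injective : ∀ t t′ → Valid t → Valid t′ → wordʸ t ≡ wordʸ t′ → t ≡ t′
wordˣ-injective (leaf p)   (leaf p′)    _ _ eq = cong leaf (List.∷-injectiveˡ eq)
wordˣ-injective (leaf p)   (node l′ r′) _ _ eq = contradiction (sym eq) (wordˣ-node≢ l′ r′)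
wordˣ-injective (node l r) (leaf p′)    _ _ eq = contradiction eq (wordˣ-node≢ l r)
wordˣ-injective (node l r) (node l′ r′) (vl , vr , _ , gt) (vl′ , vr′ , _ , gt′) eq =
  let h , w , e , f = wordʸ-head r
      h′ , w′ , e′ , f′ = wordʸ-head r′
      eqˡ , eqʳ = ++-split-unique y
        e  f  (All.map (<-≤-trans gt ∘ proj₂) (wordˣ-min l vl)) (All.map proj₂ (wordʸ-min r vr))
        e′ f′ (All.map (<-≤-trans gt′ ∘ proj₂) (wordˣ-min l′ vl′)) (All.map proj₂ (wordʸ-min r′ vr′)) eq
  in cong₂ node (wordˣ-injective l l′ vl vl′ eqˡ) (wordʸ-injective r r′ vr vr′ eqʳ)
wordʸ-injective (leaf p)   (leaf p′)    _ _ eq = cong leaf (List.∷-injectiveˡ eq)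
wordʸ-injective (leaf p)   (node l′ r′) _ _ eq = contradiction (sym eq) (wordʸ-node≢ l′ r′)
wordʸ-injective (node l r) (leaf p′)    _ _ eq = contradiction eq (wordʸ-node≢ l r)
wordʸ-injective (node l r) (node l′ r′) (vl , vr , lt , _) (vl′ , vr′ , lt′ , _) eq =
  let h , w , e , f = wordˣ-head l
      h′ , w′ , e′ , f′ = wordˣ-head l′
      eqʳ , eqˡ = ++-split-unique x
        e  f  (All.map (<-≤-trans lt ∘ proj₁) (wordʸ-min r vr)) (All.map proj₁ (wordˣ-min l vl))
        e′ f′ (All.map (<-≤-trans lt′ ∘ proj₁) (wordʸ-min r′ vr′)) (All.map proj₁ (wordˣ-min l′ vl′)) eq
  in cong₂ node (wordˣ-injective l l′ vl vl′ eqˡ) (wordʸ-injective r r′ vr vr′ eqʳ)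

word-∷≢ : ∀ t ts → word (t ∷ ts) ≢ []
word-∷≢ t ts eq with h , w , e , _ ← wordˣ-head t rewrite e
  with () ← List.++-conicalʳ (word ts) _ eq

-- The factor of the head tree starts at the first minimum of `x` in the whole word, since all other
-- trees have larger `mx`.
word-injective : ∀ {ts ts′} → All Valid ts → AllPairs _≺_ ts → All Valid ts′ → AllPairs _≺_ ts′ →
                 word ts ≡ word ts′ → ts ≡ ts′
word-injective {[]}     {[]}       _ _ _ _ _  = refl
word-injective {[]}     {t′ ∷ ts′} _ _ _ _ eq = contradiction (sym eq) (word-∷≢ t′ ts′)
word-injective {t ∷ ts} {[]}       _ _ _ _ eq = contradiction eq (word-∷≢ t ts)
word-injective {t ∷ ts} {t′ ∷ ts′} (v ∷ vs) (m ∷ ms) (v′ ∷ vs′) (m′ ∷ ms′) eq =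
  let h , w , e , f = wordˣ-head t
      h′ , w′ , e′ , f′ = wordˣ-head t′
      eqᵗˢ , eqᵗ = ++-split-unique x
        e  f  (word-min t vs m) (All.map proj₁ (wordˣ-min t v))
        e′ f′ (word-min t′ vs′ m′) (All.map proj₁ (wordˣ-min t′ v′)) eq
  in cong₂ _∷_ (wordˣ-injective t t′ v v′ eqᵗ) (word-injective vs ms vs′ ms′ eqᵗˢ)

-- Existence of factorisations: parsing words into trees.

Apart : Rel Point 0ℓ
Apart p q = x p ≢ x q × y p ≢ y q

Apart-sym : Symmetric Apart
Apart-sym (a , b) = a ∘ sym , b ∘ sym

StrictSplit : (Point → ℕ) → List Point → Set
StrictSplit f s = ∃[ u ] ∃[ b ] ∃[ v ]
  (s ≡ u ++ b ∷ v × All (λ q → f b < f q) u × All (λ q → f b < f q) v)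

split-at-min : ∀ f h s → AllPairs (λ p q → f p ≢ f q) (h ∷ s) → StrictSplit f (h ∷ s)
split-at-min f h []      _ = [] , h , [] , refl , [] , []
split-at-min f h (q ∷ s) (d ∷ ds)
  with u , b , v , eq , bs , as ← split-at-min f q s ds
  with <-cmp (f h) (f b)
... | tri< lt _ _ = [] , h , q ∷ s , refl , [] ,
      subst (All _) (sym eq) (All.++⁺ (All.map (<-trans lt) bs) (lt ∷ All.map (<-trans lt) as))
... | tri≈ _ e _  = contradiction e (All.lookup d (subst (b ∈_) (sym eq) (∈-++⁺ʳ u (here refl))))
... | tri> _ _ gt = h ∷ u , b , v , cong (h ∷_) eq , gt ∷ bs , as

mx-wordʸ : ∀ t → ∃[ v ] (v ∈ wordʸ t × x v ≡ mx t)
mx-wordʸ t = let v , i , e = mx-leaf t in v , ∈-resp-↭ (↭-sym (wordʸ-↭ t)) i , e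

my-wordˣ : ∀ t → ∃[ v ] (v ∈ wordˣ t × y v ≡ my t)
my-wordˣ t = let v , i , e = my-leaf t in v , ∈-resp-↭ (↭-sym (wordˣ-↭ t)) i , e

wordˣ-mx : ∀ t {h w} → wordˣ t ≡ h ∷ w → x h ≡ mx t
wordˣ-mx t eq with _ , _ , e , f ← wordˣ-head t
  with refl ← List.∷-injectiveˡ (≡-trans (sym e) eq) = f

wordʸ-my : ∀ t {h w} → wordʸ t ≡ h ∷ w → y h ≡ my t
wordʸ-my t eq with _ , _ , e , f ← wordʸ-head t
  with refl ← List.∷-injectiveˡ (≡-trans (sym e) eq) = f

length-++-∷ : ∀ {A : Set} (u : List A) {b v} → length (u ++ b ∷ v) ≡ suc (length u + length v)
length-++-∷ u {b} {v} = ≡-trans (List.length-++ u) (+-suc (length u) (length v))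

-- The bound `k` makes the recursion on both factors structural. The head is the minimum of one
-- coordinate and the cut goes in front of the minimum of the other, so each factor starts with the
-- minimum that its recursive call asks for.
parseˣ : ∀ k h s → length s < k → Linked NoRise (h ∷ s) → AllPairs Apart (h ∷ s) →
         All (λ q → x h < x q) s → ∃[ t ] (Valid t × wordˣ t ≡ h ∷ s)
parseʸ : ∀ k h s → length s < k → Linked NoRise (h ∷ s) → AllPairs Apart (h ∷ s) →
         All (λ q → y h < y q) s → ∃[ t ] (Valid t × wordʸ t ≡ h ∷ s)
parseˣ (suc k) h s len nr ap min
  with split-at-min y h s (AllPairs.map proj₂ ap)
... | [] , b , [] , refl , _ , _ = leaf h , tt , refl
-- The head is the minimum of both coordinates here, so the step to `q` would be a common rise.
... | [] , b , q ∷ v , refl , _ , as = contradiction (All.head min , All.head as) (Linked.head nr)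
... | h ∷ u , b , v , refl , lt ∷ bs , as =
  let len′ = ≤-trans (≤-reflexive (cong suc (sym (length-++-∷ u)))) len
      nrˡ , nrʳ = Linked-++⁻ (h ∷ u) nr
      apˡ , apʳ , _ = AllPairs-++⁻ (h ∷ u) ap
      minˡ , minʳ = All.++⁻ u min
      l , vl , el = parseˣ k h u (≤-trans (s≤s (m≤m+n (length u) (length v))) (s≤s⁻¹ len′)) nrˡ apˡ minˡ
      r , vr , er = parseʸ k b v (≤-trans (s≤s (m≤n+m (length v) (length u))) (s≤s⁻¹ len′)) nrʳ apʳ as
      -- Points attaining `mx r` and `my l`: comparing them with the minima `h` and `b` gives the
      -- two inequalities of `Valid`.
      p , p∈ , ep = mx-wordʸ r
      q , q∈ , eq = my-wordˣ l
  in node l r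
   , (vl , vr
     , subst (_< mx r) (wordˣ-mx l el) (subst (x h <_) ep (All.lookup minʳ (subst (p ∈_) er p∈)))
     , subst (_< my l) (wordʸ-my r er) (subst (y b <_) eq (All.lookup (lt ∷ bs) (subst (q ∈_) el q∈))))
   , cong₂ _++_ el er
parseʸ (suc k) h s len nr ap min
  with split-at-min x h s (AllPairs.map proj₁ ap)
... | [] , b , [] , refl , _ , _ = leaf h , tt , refl
... | [] , b , q ∷ v , refl , _ , as = contradiction (All.head as , All.head min) (Linked.head nr)
... | h ∷ u , b , v , refl , lt ∷ bs , as =
  let len′ = ≤-trans (≤-reflexive (cong suc (sym (length-++-∷ u)))) len
      nrʳ , nrˡ = Linked-++⁻ (h ∷ u) nr
      apʳ , apˡ , _ = AllPairs-++⁻ (h ∷ u) ap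
      minʳ , minˡ = All.++⁻ u min
      r , vr , er = parseʸ k h u (≤-trans (s≤s (m≤m+n (length u) (length v))) (s≤s⁻¹ len′)) nrʳ apʳ minʳ
      l , vl , el = parseˣ k b v (≤-trans (s≤s (m≤n+m (length v) (length u))) (s≤s⁻¹ len′)) nrˡ apˡ as
      p , p∈ , ep = mx-wordʸ r
      q , q∈ , eq = my-wordˣ l
  in node l r
   , (vl , vr
     , subst (_< mx r) (wordˣ-mx l el) (subst (x b <_) ep (All.lookup (lt ∷ bs) (subst (p ∈_) er p∈)))
     , subst (_< my l) (wordʸ-my r er) (subst (y h <_) eq (All.lookup minˡ (subst (q ∈_) el q∈))))
   , cong₂ _++_ er el

mx-word : ∀ ts {t} → t ∈ ts → ∃[ v ] (v ∈ word ts × x v ≡ mx t)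
mx-word ts {t} i = let v , j , e = mx-leaf t in
  v , ∈-resp-↭ (↭-sym (word-↭ ts)) (∈-concatMap⁺ treeLeaves (lose i j)) , e

-- From the minimum of `x` onwards the word is of the first kind and yields the head tree. Each tree
-- parsed from the part before has larger `mx`, that value being the abscissa of a point of `u`.
parse : ∀ k s → length s ≤ k → Linked NoRise s → AllPairs Apart s →
        ∃[ ts ] (All Valid ts × AllPairs _≺_ ts × word ts ≡ s)
parse k       []      _   _  _  = [] , [] , [] , refl
parse (suc k) (h ∷ s) len nr ap
  with split-at-min x h s (AllPairs.map proj₁ ap)
... | u , b , v , eq , bs , as rewrite eq =
  let len′ = ≤-trans (≤-reflexive (sym (length-++-∷ u))) (≤-trans (≤-reflexive (cong length (sym eq))) len)
      nrᵘ , nrᵛ = Linked-++⁻ u nr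
      apᵘ , apᵛ , _ = AllPairs-++⁻ u ap
      ts , vs , ms , e = parse k u (≤-trans (m≤m+n (length u) (length v)) (s≤s⁻¹ len′)) nrᵘ apᵘ
      t , vt , et = parseˣ (suc (length v)) b v ≤-refl nrᵛ apᵛ as
  in t ∷ ts , vt ∷ vs
   , All.tabulate (λ {t′} i → let q , q∈ , f = mx-word ts i in
       subst (_< mx t′) (wordˣ-mx t et) (subst (x b <_) f (All.lookup bs (subst (q ∈_) e q∈)))) ∷ ms
   , cong₂ _++_ e et

-- Point sets of forests

-- A branching point takes its abscissa from a leaf of its left subtree. Hence disjointness of
-- columns, and by `pts-y` of rows, need only be known for leaves.
pts-x : ∀ t {p} → p ∈ treePts t → ∃[ v ] (v ∈ treeLeaves t × x v ≡ x p)
pts-x (leaf _)   {p} i = p , i , refl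
pts-x (node l r) i with pts-node⁻ l r i
... | at-root refl = let v , j , e = mx-leaf l in v , ∈-++⁺ˡ j , e
... | in-left j    = let v , k , e = pts-x l j in v , ∈-++⁺ˡ k , e
... | in-right j   = let v , k , e = pts-x r j in v , ∈-++⁺ʳ (treeLeaves l) k , e

pts-y : ∀ t {p} → p ∈ treePts t → ∃[ v ] (v ∈ treeLeaves t × y v ≡ y p)
pts-y (leaf _)   {p} i = p , i , refl
pts-y (node l r) i with pts-node⁻ l r i
... | at-root refl = let v , j , e = my-leaf r in v , ∈-++⁺ʳ (treeLeaves l) j , e
... | in-left j    = let v , k , e = pts-y l j in v , ∈-++⁺ˡ k , e
... | in-right j   = let v , k , e = pts-y r j in v , ∈-++⁺ʳ (treeLeaves l) k , e

Separated : List Point → Set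
Separated = AllPairs Apart

Aligned : Rel Point 0ℓ
Aligned p q = x p ≡ x q ⊎ y p ≡ y q

pts-apart : ∀ s t → (∀ {u v} → u ∈ treeLeaves s → v ∈ treeLeaves t → Apart u v) →
            ∀ {p q} → p ∈ treePts s → q ∈ treePts t → ¬ Aligned p q
pts-apart s t ap i j (inj₁ e) =
  let u , u∈ , eu = pts-x s i
      v , v∈ , ev = pts-x t j
  in proj₁ (ap u∈ v∈) (≡-trans eu (≡-trans e (sym ev)))
pts-apart s t ap i j (inj₂ e) =
  let u , u∈ , eu = pts-y s i
      v , v∈ , ev = pts-y t j
  in proj₂ (ap u∈ v∈) (≡-trans eu (≡-trans e (sym ev)))

children-apart : ∀ l r → Separated (treeLeaves (node l r)) →
                 ∀ {p q} → p ∈ treePts l → q ∈ treePts r → ¬ Aligned p q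
children-apart l r sep = pts-apart l r λ i j →
  All.lookup (All.lookup (proj₂ (proj₂ (AllPairs-++⁻ (treeLeaves l) sep))) i) j

infix 4 _∈ᶠ_

_∈ᶠ_ : Point → List Tree → Set
p ∈ᶠ ts = Any (λ t → p ∈ treePts t) ts

-- Trees with separated leaves occupy disjoint rows and columns. This reduces every question about a
-- row or column of the forest to a single tree.
same-tree : ∀ {ts} → Separated (forestLeaves ts) → ∀ {s t p q} → s ∈ ts → t ∈ ts →
            p ∈ treePts s → q ∈ treePts t → Aligned p q → s ≡ t
same-tree sep (here refl) (here refl) _ _ _ = refl
same-tree {s ∷ ts} sep {t = t} (here refl) (there j) p∈ q∈ al = contradiction al
  (pts-apart s t (λ u∈ v∈ → All.lookup (All.lookup (proj₂ (proj₂ (AllPairs-++⁻ (treeLeaves s) sep))) u∈)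
    (∈-concatMap⁺ treeLeaves (lose j v∈))) p∈ q∈)
same-tree {t ∷ ts} sep {s = s} (there i) (here refl) p∈ q∈ al = contradiction al
  (pts-apart s t (λ u∈ v∈ → Apart-sym (All.lookup (All.lookup (proj₂ (proj₂ (AllPairs-++⁻ (treeLeaves t) sep))) v∈)
    (∈-concatMap⁺ treeLeaves (lose i u∈)))) p∈ q∈)
same-tree {t ∷ ts} sep (there i) (there j) =
  same-tree (proj₁ (proj₂ (AllPairs-++⁻ (treeLeaves t) sep))) i j

tree-separated : ∀ {ts} → Separated (forestLeaves ts) → ∀ {t} → t ∈ ts → Separated (treeLeaves t)
tree-separated {t ∷ ts} sep (here refl) = proj₁ (AllPairs-++⁻ (treeLeaves t) sep)
tree-separated {t ∷ ts} sep (there i)   = tree-separated (proj₁ (proj₂ (AllPairs-++⁻ (treeLeaves t) sep))) i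

-- The root has nothing below it. For `p` in `l`, the points `q` and `s` lie in `l` or are the root.
-- If `q` is the root, `p` is in the first column and `s` cannot be to its left; `s` is not the
-- root, since `l` lies above the root's row. The case of `r` is symmetric.
tree-nonAmbiguous : ∀ t → Valid t → Separated (treeLeaves t) → NonAmbiguous (treePts t)
tree-nonAmbiguous (leaf v) _ _ (_ , here refl , _ , (here refl , _ , lt) , _) = <-irrefl refl lt
tree-nonAmbiguous (node l r) v@(vl , vr , lt , gt) sep (p , p∈ , q , (q∈ , xq , yq) , s , (s∈ , ys , xs))
  with pts-node⁻ l r p∈ | pts-node⁻ l r q∈ | pts-node⁻ l r s∈
... | at-root refl | _            | _            = ≤⇒≯ (proj₂ (root-min (node l r) v q∈)) yq
... | in-left i    | at-root refl | _            = ≤⇒≯ (proj₁ (root-min (node l r) v s∈)) (subst (x s <_) (sym xq) xs)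
... | in-left i    | in-right j   | _            = children-apart l r sep i j (inj₁ (sym xq))
... | in-left i    | in-left j    | at-root refl = <-irrefl ys (<-≤-trans gt (proj₂ (root-min l vl i)))
... | in-left i    | in-left j    | in-right k   = children-apart l r sep i k (inj₂ (sym ys))
... | in-left i    | in-left j    | in-left k    =
  tree-nonAmbiguous l vl (proj₁ (AllPairs-++⁻ (treeLeaves l) sep)) (p , i , q , (j , xq , yq) , s , (k , ys , xs))
... | in-right i   | _            | at-root refl = ≤⇒≯ (proj₂ (root-min (node l r) v q∈)) (subst (y q <_) (sym ys) yq)
... | in-right i   | _            | in-left k    = children-apart l r sep k i (inj₂ ys)
... | in-right i   | at-root refl | in-right k   = <-irrefl xq (<-≤-trans lt (proj₁ (root-min r vr i)))
... | in-right i   | in-left j    | in-right k   = children-apart l r sep j i (inj₁ xq)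
... | in-right i   | in-right j   | in-right k   =
  tree-nonAmbiguous r vr (proj₁ (proj₂ (AllPairs-++⁻ (treeLeaves l) sep))) (p , i , q , (j , xq , yq) , s , (k , ys , xs))

-- Makes roots recognisable from the point set alone, which is what allows two forests with the same
-- points to be compared.
nonroot-parent : ∀ t → Valid t → ∀ {p} → p ∈ treePts t →
                 p ≡ root t ⊎ ∃[ q ] (Below (treePts t) q p ⊎ LeftOf (treePts t) q p)
nonroot-parent (leaf _)   _ (here refl) = inj₁ refl
nonroot-parent (node l r) (vl , vr , lt , gt) i with pts-node⁻ l r i
... | at-root e = inj₁ e
... | in-left j with nonroot-parent l vl j
...   | inj₁ refl = inj₂ (_ , inj₁ (here refl , refl , gt))
...   | inj₂ (q , inj₁ (k , e)) = inj₂ (q , inj₁ (pts-left l r k , e))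
...   | inj₂ (q , inj₂ (k , e)) = inj₂ (q , inj₂ (pts-left l r k , e))
nonroot-parent (node l r) (vl , vr , lt , gt) i | in-right j with nonroot-parent r vr j
...   | inj₁ refl = inj₂ (_ , inj₂ (here refl , refl , lt))
...   | inj₂ (q , inj₁ (k , e)) = inj₂ (q , inj₁ (pts-right l r k , e))
...   | inj₂ (q , inj₂ (k , e)) = inj₂ (q , inj₂ (pts-right l r k , e))

-- Nearest neighbours and the trees that they determine.

module _ (A : List Point) where

  -- The forest structure seen from the parent: in a non-ambiguous set the children of `p` are
  -- exactly its nearest points above and to the right.
  NextUp NextRight : Point → Point → Set
  NextUp p c    = c ∈ A × x c ≡ x p × y p < y c × (∀ {q} → q ∈ A → x q ≡ x p → y p < y q → y c ≤ y q)
  NextRight p c = c ∈ A × y c ≡ y p × x p < x c × (∀ {q} → q ∈ A → y q ≡ y p → x p < x q → x c ≤ x q)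

  Terminal : Point → Set
  Terminal p = (∀ {q} → q ∈ A → x q ≡ x p → ¬ y p < y q) × (∀ {q} → q ∈ A → y q ≡ y p → ¬ x p < x q)

  Drawn : Tree → Set
  Drawn (leaf p)   = Terminal p
  Drawn (node l r) = NextUp (root (node l r)) (root l) × NextRight (root (node l r)) (root r) × Drawn l × Drawn r

  NextUp-unique : ∀ {p c c′} → NextUp p c → NextUp p c′ → c ≡ c′
  NextUp-unique (i , e , lt , m) (i′ , e′ , lt′ , m′) =
    cong₂ _,_ (≡-trans e (sym e′)) (≤-antisym (m i′ e′ lt′) (m′ i e lt))

  NextRight-unique : ∀ {p c c′} → NextRight p c → NextRight p c′ → c ≡ c′
  NextRight-unique (i , e , lt , m) (i′ , e′ , lt′ , m′) =
    cong₂ _,_ (≤-antisym (m i′ e′ lt′) (m′ i e lt)) (≡-trans e (sym e′))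

  -- Nearest neighbours are unique and a terminal point has none, so a drawn tree can be unfolded
  -- from its root.
  Drawn-unique : ∀ t t′ → Drawn t → Drawn t′ → root t ≡ root t′ → t ≡ t′
  Drawn-unique (leaf p)   (leaf p′)    _ _ e = cong leaf e
  Drawn-unique (leaf p)   (node l′ r′) (term , _) ((i , xe , lt , _) , _) refl = contradiction lt (term i xe)
  Drawn-unique (node l r) (leaf p′)    ((i , xe , lt , _) , _) (term , _) refl = contradiction lt (term i xe)
  Drawn-unique (node l r) (node l′ r′) (u , w , dl , dr) (u′ , w′ , dl′ , dr′) e =
    cong₂ node
      (Drawn-unique l l′ dl dl′ (NextUp-unique u (subst (λ p → NextUp p (root l′)) (sym e) u′)))
      (Drawn-unique r r′ dr dr′ (NextRight-unique w (subst (λ p → NextRight p (root r′)) (sym e) w′)))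

  -- The two bounds exclude ancestors, which share a row or column with the tree but lie below or to
  -- the left of it. They are what lets closedness pass to subtrees.
  Closed : Tree → Set
  Closed t = ∀ {p v} → p ∈ A → v ∈ treePts t → Aligned v p → mx t ≤ x p → my t ≤ y p → p ∈ treePts t

  Closed-left : ∀ {l r} → Valid (node l r) → Separated (treeLeaves (node l r)) → Closed (node l r) → Closed l
  Closed-left {l} {r} (_ , _ , _ , gt) sep cl p∈ v∈ al mx≤ my≤
    with pts-node⁻ l r (cl p∈ (pts-left l r v∈) al mx≤ (≤-trans (<⇒≤ gt) my≤))
  ... | at-root refl = contradiction gt (≤⇒≯ my≤)
  ... | in-left i    = i
  ... | in-right i   = contradiction al (children-apart l r sep v∈ i)

  Closed-right : ∀ {l r} → Valid (node l r) → Separated (treeLeaves (node l r)) → Closed (node l r) → Closed r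
  Closed-right {l} {r} (_ , _ , lt , _) sep cl p∈ v∈ al mx≤ my≤
    with pts-node⁻ l r (cl p∈ (pts-right l r v∈) al (≤-trans (<⇒≤ lt) mx≤) my≤)
  ... | at-root refl = contradiction lt (≤⇒≯ mx≤)
  ... | in-right i   = i
  ... | in-left i    = contradiction (Sum.map sym sym al) (children-apart l r sep i v∈)

  -- By closedness the column above the root meets only `l` and the row to its right only `r`; there
  -- `root l` and `root r` come first by `root-min`.
  Closed⇒Drawn : ∀ t → Valid t → Separated (treeLeaves t) → (∀ {p} → p ∈ treePts t → p ∈ A) →
                 Closed t → Drawn t
  Closed⇒Drawn (leaf v) _ _ _ cl = term-up , term-right
    where
    term-up : ∀ {q} → q ∈ A → x q ≡ x v → ¬ y v < y q
    term-up i e lt with here refl ← cl i (here refl) (inj₁ (sym e)) (≤-reflexive (sym e)) (<⇒≤ lt) = <-irrefl refl lt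
    term-right : ∀ {q} → q ∈ A → y q ≡ y v → ¬ x v < x q
    term-right i e lt with here refl ← cl i (here refl) (inj₂ (sym e)) (<⇒≤ lt) (≤-reflexive (sym e)) = <-irrefl refl lt
  Closed⇒Drawn (node l r) v@(vl , vr , lt , gt) sep ⊆A cl =
    (⊆A (pts-left l r (root∈ l)) , refl , gt , up) , (⊆A (pts-right l r (root∈ r)) , refl , lt , right) ,
    Closed⇒Drawn l vl (proj₁ seps) (⊆A ∘ pts-left l r) (Closed-left v sep cl) ,
    Closed⇒Drawn r vr (proj₁ (proj₂ seps)) (⊆A ∘ pts-right l r) (Closed-right v sep cl)
    where
    seps = AllPairs-++⁻ (treeLeaves l) sep
    up : ∀ {q} → q ∈ A → x q ≡ mx l → my r < y q → my l ≤ y q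
    up i e lt′ with pts-node⁻ l r (cl i (here refl) (inj₁ (sym e)) (≤-reflexive (sym e)) (<⇒≤ lt′))
    ... | at-root refl = contradiction lt′ (<-irrefl refl)
    ... | in-left j    = proj₂ (root-min l vl j)
    ... | in-right j   = contradiction (inj₁ (sym e)) (children-apart l r sep (root∈ l) j)
    right : ∀ {q} → q ∈ A → y q ≡ my r → mx l < x q → mx r ≤ x q
    right i e lt′ with pts-node⁻ l r (cl i (here refl) (inj₂ (sym e)) (<⇒≤ lt′) (≤-reflexive (sym e)))
    ... | at-root refl = contradiction lt′ (<-irrefl refl)
    ... | in-right j   = proj₁ (root-min r vr j)
    ... | in-left j    = contradiction (inj₂ e) (children-apart l r sep j (root∈ r))

  Drawn-leaf : ∀ t → Drawn t → ∀ {p} → p ∈ treeLeaves t → Terminal p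
  Drawn-leaf (leaf _)   term (here refl) = term
  Drawn-leaf (node l r) (_ , _ , dl , dr) i with ∈-++⁻ (treeLeaves l) i
  ... | inj₁ j = Drawn-leaf l dl j
  ... | inj₂ j = Drawn-leaf r dr j

  Drawn-pts : ∀ t → Drawn t → ∀ {p} → p ∈ treePts t →
              p ∈ treeLeaves t ⊎ ∃₂ λ c c′ → NextUp p c × NextRight p c′
  Drawn-pts (leaf _)   _ i = inj₁ i
  Drawn-pts (node l r) (u , w , dl , dr) i with pts-node⁻ l r i
  ... | at-root refl = inj₂ (root l , root r , u , w)
  ... | in-left j    = Sum.map₁ ∈-++⁺ˡ (Drawn-pts l dl j)
  ... | in-right j   = Sum.map₁ (∈-++⁺ʳ (treeLeaves l)) (Drawn-pts r dr j)

  NextUp⇒IsParent : ∀ {p c} → p ∈ A → NextUp p c → IsParent A p c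
  NextUp⇒IsParent {p} {c} p∈ (_ , e , lt , m) = inj₁ ((p∈ , sym e , lt) , max)
    where
    max : ∀ q → Below A q c → y q ≤ y p
    max q (q∈ , e′ , lt′) = ≮⇒≥ λ gt → ≤⇒≯ (m q∈ (≡-trans e′ e) gt) lt′

  -- A point below `c` would take precedence as parent; non-ambiguity excludes it because `p` is to
  -- the left of `c`.
  NextRight⇒IsParent : NonAmbiguous A → ∀ {p c} → p ∈ A → NextRight p c → IsParent A p c
  NextRight⇒IsParent na {p} {c} p∈ (c∈ , e , lt , m) =
    inj₂ ((λ q b → na (c , c∈ , q , b , p , p∈ , sym e , lt)) , (p∈ , sym e , lt) , max)
    where
    max : ∀ q → LeftOf A q c → x q ≤ x p
    max q (q∈ , e′ , lt′) = ≮⇒≥ λ gt → ≤⇒≯ (m q∈ (≡-trans e′ e) gt) lt′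

  IsParent⁻ : ∀ {p c} → c ∈ A → IsParent A p c → NextUp p c ⊎ NextRight p c
  IsParent⁻ c∈ (inj₁ ((p∈ , e , lt) , max)) =
    inj₁ (c∈ , sym e , lt , λ q∈ e′ gt → ≮⇒≥ λ lt′ → ≤⇒≯ (max _ (q∈ , ≡-trans e′ e , lt′)) gt)
  IsParent⁻ c∈ (inj₂ (_ , (p∈ , e , lt) , max)) =
    inj₂ (c∈ , sym e , lt , λ q∈ e′ gt → ≮⇒≥ λ lt′ → ≤⇒≯ (max _ (q∈ , ≡-trans e′ e , lt′)) gt)

-- `A` is tied to the forest by two inclusions instead of an equation, so that one set can be viewed
-- as the drawing of two forests.
module Drawing {A ts} (vs : All Valid ts) (sep : Separated (forestLeaves ts))
               (A⊆ : ∀ {p} → p ∈ A → p ∈ᶠ ts) (⊆A : ∀ {p} → p ∈ᶠ ts → p ∈ A) where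

  in-tree : ∀ {t p q} → t ∈ ts → p ∈ treePts t → q ∈ A → Aligned p q → q ∈ treePts t
  in-tree t∈ p∈ q∈ al with t′ , t′∈ , i ← find (A⊆ q∈)
    with refl ← same-tree sep t∈ t′∈ p∈ i al = i

  drawn : ∀ {t} → t ∈ ts → Drawn A t
  drawn {t} t∈ = Closed⇒Drawn A t (All.lookup vs t∈) (tree-separated sep t∈) (⊆A ∘ lose t∈)
    λ q∈ v∈ al _ _ → in-tree t∈ v∈ q∈ al

  root-lowest : ∀ {t q} → t ∈ ts → ¬ Below A q (root t)
  root-lowest {t} t∈ (q∈ , e , lt) =
    ≤⇒≯ (proj₂ (root-min t (All.lookup vs t∈) (in-tree t∈ (root∈ t) q∈ (inj₁ (sym e))))) lt

  root-leftmost : ∀ {t q} → t ∈ ts → ¬ LeftOf A q (root t)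
  root-leftmost {t} t∈ (q∈ , e , lt) =
    ≤⇒≯ (proj₁ (root-min t (All.lookup vs t∈) (in-tree t∈ (root∈ t) q∈ (inj₂ (sym e))))) lt

  nonAmbiguous : NonAmbiguous A
  nonAmbiguous (p , p∈ , q , (q∈ , xq , yq) , s , (s∈ , ys , xs))
    with t , t∈ , i ← find (A⊆ p∈) =
    tree-nonAmbiguous t (All.lookup vs t∈) (tree-separated sep t∈)
      (p , i , q , (in-tree t∈ i q∈ (inj₁ (sym xq)) , xq , yq) , s , (in-tree t∈ i s∈ (inj₂ (sym ys)) , ys , xs))

  terminal⇒childless : ∀ {p} → Terminal A p → ∀ c → c ∈ A → ¬ IsParent A p c
  terminal⇒childless (tu , tr) c c∈ par with IsParent⁻ A c∈ par
  ... | inj₁ (_ , e , lt , _) = tu c∈ e lt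
  ... | inj₂ (_ , e , lt , _) = tr c∈ e lt

  leaf-terminal : ∀ {p} → p ∈ forestLeaves ts → Terminal A p
  leaf-terminal i with t , t∈ , j ← find (∈-concatMap⁻ treeLeaves i) = Drawn-leaf A t (drawn t∈) j

  leaf∈ : ∀ {p} → p ∈ forestLeaves ts → p ∈ A
  leaf∈ i with t , t∈ , j ← find (∈-concatMap⁻ treeLeaves i) = ⊆A (lose t∈ (leaf⊆pts t j))

  leaf-or-branch : ∀ {p} → p ∈ A → p ∈ forestLeaves ts ⊎ ∃₂ λ c c′ → NextUp A p c × NextRight A p c′
  leaf-or-branch p∈ with t , t∈ , i ← find (A⊆ p∈) =
    Sum.map₁ (λ j → ∈-concatMap⁺ treeLeaves (lose t∈ j)) (Drawn-pts A t (drawn t∈) i)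

  isComplete : Complete A
  isComplete p p∈ with leaf-or-branch p∈
  ... | inj₁ i = inj₁ (terminal⇒childless (leaf-terminal i))
  ... | inj₂ (c , c′ , u , w) = inj₂ (c , c′ , proj₁ u , NextUp⇒IsParent A p∈ u , proj₁ w ,
        NextRight⇒IsParent A nonAmbiguous p∈ w ,
        -- `c` lies in the column of `p` and `c′` strictly to the right of it.
        (λ e → <-irrefl (sym (≡-trans (cong x (sym e)) (proj₁ (proj₂ u)))) (proj₁ (proj₂ (proj₂ w)))) ,
        λ d d∈ par → Sum.map (λ u′ → NextUp-unique A u′ u) (λ w′ → NextRight-unique A w′ w) (IsParent⁻ A d∈ par))

  isLeaf⇔ : ∀ p → IsLeaf A p ⇔ p ∈ forestLeaves ts
  isLeaf⇔ p = mk⇔ to λ i → leaf∈ i , terminal⇒childless (leaf-terminal i)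
    where
    to : IsLeaf A p → p ∈ forestLeaves ts
    to (p∈ , childless) with leaf-or-branch p∈
    ... | inj₁ i = i
    ... | inj₂ (c , _ , u , _) = contradiction (NextUp⇒IsParent A p∈ u) (childless c (proj₁ u))

-- The root of `t` has nothing below or to the left of it in `A`, so it is also the root of the tree
-- `t′` containing it in the other forest. Both trees are drawn in `A` from that root, hence equal.
forest-⊆ : ∀ {A ts ts′} → All Valid ts → Separated (forestLeaves ts) →
           All Valid ts′ → Separated (forestLeaves ts′) →
           (∀ {p} → p ∈ A → p ∈ᶠ ts) → (∀ {p} → p ∈ᶠ ts → p ∈ A) →
           (∀ {p} → p ∈ A → p ∈ᶠ ts′) → (∀ {p} → p ∈ᶠ ts′ → p ∈ A) →
           ∀ {t} → t ∈ ts → t ∈ ts′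
forest-⊆ {A} vs sep vs′ sep′ A⊆ ⊆A A⊆′ ⊆A′ {t} t∈
  with t′ , t′∈ , i ← find (A⊆′ (⊆A (lose t∈ (root∈ t))))
  with nonroot-parent t′ (All.lookup vs′ t′∈) i
... | inj₁ e = subst (_∈ _) (Drawn-unique A t′ t (D′.drawn t′∈) (D.drawn t∈) (sym e)) t′∈
  where
  module D  = Drawing vs sep A⊆ ⊆A
  module D′ = Drawing vs′ sep′ A⊆′ ⊆A′
... | inj₂ (q , inj₁ (q∈ , b)) = contradiction (⊆A′ (lose t′∈ q∈) , b) (Drawing.root-lowest vs sep A⊆ ⊆A t∈)
... | inj₂ (q , inj₂ (q∈ , b)) = contradiction (⊆A′ (lose t′∈ q∈) , b) (Drawing.root-leftmost vs sep A⊆ ⊆A t∈)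

-- Growing a forest from its point set

-- A column other than the first begins at the root of a right subtree, and the parent of that root
-- is to its left. Adding a point below such a column would make the set ambiguous.
left-of-column : ∀ t → Valid t → ∀ {p} → p ∈ treePts t →
  x p ≡ mx t ⊎ ∃₂ λ p′ q → p′ ∈ treePts t × x p′ ≡ x p × LeftOf (treePts t) q p′
left-of-column (leaf _)   _ (here refl) = inj₁ refl
left-of-column (node l r) (vl , vr , lt , gt) i with pts-node⁻ l r i
... | at-root refl = inj₁ refl
... | in-left j with left-of-column l vl j
...   | inj₁ e = inj₁ e
...   | inj₂ (p′ , q , p′∈ , e , q∈ , b) = inj₂ (p′ , q , pts-left l r p′∈ , e , pts-left l r q∈ , b)
left-of-column (node l r) (vl , vr , lt , gt) i | in-right j with left-of-column r vr j
...   | inj₁ e = inj₂ (root r , root (node l r) , pts-right l r (root∈ r) , sym e , here refl , refl , lt)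
...   | inj₂ (p′ , q , p′∈ , e , q∈ , b) = inj₂ (p′ , q , pts-right l r p′∈ , e , pts-right l r q∈ , b)

below-row : ∀ t → Valid t → ∀ {p} → p ∈ treePts t →
  y p ≡ my t ⊎ ∃₂ λ p′ q → p′ ∈ treePts t × y p′ ≡ y p × Below (treePts t) q p′
below-row (leaf _)   _ (here refl) = inj₁ refl
below-row (node l r) (vl , vr , lt , gt) i with pts-node⁻ l r i
... | at-root refl = inj₁ refl
... | in-right j with below-row r vr j
...   | inj₁ e = inj₁ e
...   | inj₂ (p′ , q , p′∈ , e , q∈ , b) = inj₂ (p′ , q , pts-right l r p′∈ , e , pts-right l r q∈ , b)
below-row (node l r) (vl , vr , lt , gt) i | in-left j with below-row l vl j
...   | inj₁ e = inj₂ (root l , root (node l r) , pts-left l r (root∈ l) , sym e , here refl , refl , gt)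
...   | inj₂ (p′ , q , p′∈ , e , q∈ , b) = inj₂ (p′ , q , pts-left l r p′∈ , e , pts-left l r q∈ , b)

IsAbove IsRight : Rel Point 0ℓ
IsAbove p u = x u ≡ x p × y p < y u
IsRight p u = y u ≡ y p × x p < x u

isAbove? : Decidable IsAbove
isAbove? p u = (x u ≟ x p) ×-dec (y p <? y u)

isRight? : Decidable IsRight
isRight? p u = (y u ≟ y p) ×-dec (x p <? x u)

_<ₚ?_ : Decidable _<ₚ_
p <ₚ? q = (x p <? x q) ⊎-dec ((x p ≟ x q) ×-dec (y p <? y q))

<ₚ-trans : Transitive _<ₚ_
<ₚ-trans (inj₁ a)       (inj₁ b)       = inj₁ (<-trans a b)
<ₚ-trans (inj₁ a)       (inj₂ (e , _)) = inj₁ (subst (_ <_) e a)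
<ₚ-trans (inj₂ (e , _)) (inj₁ b)       = inj₁ (subst (_< _) (sym e) b)
<ₚ-trans (inj₂ (e , a)) (inj₂ (f , b)) = inj₂ (≡-trans e f , <-trans a b)

<ₚ-asym : Asymmetric _<ₚ_
<ₚ-asym (inj₁ a)       (inj₁ b)       = <-asym a b
<ₚ-asym (inj₁ a)       (inj₂ (e , _)) = <-irrefl (sym e) a
<ₚ-asym (inj₂ (e , _)) (inj₁ b)       = <-irrefl (sym e) b
<ₚ-asym (inj₂ (_ , a)) (inj₂ (_ , b)) = <-asym a b

≢⇒<ₚ⊎>ₚ : ∀ {p q} → p ≢ q → p <ₚ q ⊎ q <ₚ p
≢⇒<ₚ⊎>ₚ {p} {q} p≢q with <-cmp (x p) (x q) | <-cmp (y p) (y q)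
... | tri< a _ _ | _          = inj₁ (inj₁ a)
... | tri> _ _ a | _          = inj₂ (inj₁ a)
... | tri≈ _ e _ | tri< a _ _ = inj₁ (inj₂ (e , a))
... | tri≈ _ e _ | tri> _ _ a = inj₂ (inj₂ (sym e , a))
... | tri≈ _ e _ | tri≈ _ f _ = contradiction (cong₂ _,_ e f) p≢q

above⇒<ₚ : ∀ {p u} → IsAbove p u → p <ₚ u
above⇒<ₚ (e , lt) = inj₂ (sym e , lt)

right⇒<ₚ : ∀ {p u} → IsRight p u → p <ₚ u
right⇒<ₚ (_ , lt) = inj₁ lt

-- V lists the leaves and B the branching points; every clause is decidable, so that a
-- computationally irrelevant proof can be recomputed.
Growable : List Point → List Point → Set
Growable V B =
    All (λ p → Any (IsAbove p) A × Any (IsRight p) A) B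
  × All (λ v → All (λ p → ¬ IsAbove v p × ¬ IsRight v p) A) V
  × All (λ p → All (λ q → All (λ s → ¬ (IsAbove q p × IsRight s p)) A) A) A
  × AllPairs _<ₚ_ B
  where A = B ++ V

growable? : ∀ V B → Dec (Growable V B)
growable? V B =
        All.all? (λ p → Any.any? (isAbove? p) A ×-dec Any.any? (isRight? p) A) B
  ×-dec All.all? (λ v → All.all? (λ p → ¬? (isAbove? v p) ×-dec ¬? (isRight? v p)) A) V
  ×-dec All.all? (λ p → All.all? (λ q → All.all? (λ s → ¬? (isAbove? q p ×-dec isRight? s p)) A) A) A
  ×-dec allPairs? _<ₚ?_ B
  where A = B ++ V

-- Points above or to the right of `p` come after `p` in the order, so the first branching point `r`
-- is never a witness for a later one.
Growable-tail : ∀ {V r B} → Growable V (r ∷ B) → Growable V B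
Growable-tail {V} {r} {B} (branch , term , na , (lt ∷ srt)) =
    All.tabulate (λ i → let u , w = All.lookup (All.tail branch) i
                            gt    = <ₚ-asym (All.lookup lt i)
                        in drop (gt ∘ above⇒<ₚ) u , drop (gt ∘ right⇒<ₚ) w)
  , All.map All.tail term
  , All.map (All.map All.tail ∘ All.tail) (All.tail na)
  , srt
  where
  drop : ∀ {P : Point → Set} → ¬ P r → Any P (r ∷ B ++ V) → Any P (B ++ V)
  drop ¬Pr (here Pr) = contradiction Pr ¬Pr
  drop ¬Pr (there i) = i

∈⇒↭∷ : ∀ {A : Set} {a : A} {as} → a ∈ as → ∃[ bs ] as ↭ a ∷ bs
∈⇒↭∷ i with bs , cs , refl ← ∈-∃++ i = bs ++ cs , shift _ bs cs

forestLeaves-↭ : ∀ {ts ts′} → ts ↭ ts′ → forestLeaves ts ↭ forestLeaves ts′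
forestLeaves-↭ refl         = ↭-refl
forestLeaves-↭ (prep t σ)   = ++⁺ (↭-refl {x = treeLeaves t}) (forestLeaves-↭ σ)
forestLeaves-↭ (swap {ts} {ts′} s t σ) =
  ↭-trans (↭-reflexive (sym (List.++-assoc (treeLeaves s) _ _)))
  (↭-trans (++⁺ (++-comm (treeLeaves s) (treeLeaves t)) (forestLeaves-↭ σ))
  (↭-reflexive (List.++-assoc (treeLeaves t) _ _)))
forestLeaves-↭ (trans σ τ)  = ↭-trans (forestLeaves-↭ σ) (forestLeaves-↭ τ)

record Grown (V A : List Point) : Set where
  constructor grown
  field
    trees  : List Tree
    valid  : All Valid trees
    leaves : forestLeaves trees ↭ V
    sound  : ∀ {p} → p ∈ᶠ trees → p ∈ A
    covers : ∀ {p} → p ∈ A → p ∈ᶠ trees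

seedlings : ∀ V → Grown V V
seedlings []      = grown [] [] ↭-refl (λ ()) (λ ())
seedlings (v ∷ V) with grown ts vs σ snd cov ← seedlings V = grown (leaf v ∷ ts) (tt ∷ vs) (prep v σ)
  (λ { (here (here e)) → here e ; (there i) → there (snd i) })
  (λ { (here e) → here (here e) ; (there i) → there (cov i) })

-- The lexicographically first branching point r has nothing below it or to its left.
-- Without r, the column and the row of r are led by roots of two different trees;
-- r becomes their common parent.
module GrowStep {V r B} (g : Growable V (r ∷ B)) (G : Grown V (B ++ V)) where

  open Grown G

  term : ∀ {v p} → v ∈ V → p ∈ r ∷ B ++ V → ¬ IsAbove v p × ¬ IsRight v p
  term i j = All.lookup (All.lookup (proj₁ (proj₂ g)) i) j

  na : ∀ {p q s} → p ∈ B ++ V → q ∈ r ∷ B ++ V → s ∈ r ∷ B ++ V → ¬ (IsAbove q p × IsRight s p)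
  na i j k = All.lookup (All.lookup (All.lookup (proj₁ (proj₂ (proj₂ g))) (there i)) j) k

  r-first : ∀ {p} → p ∈ B → r <ₚ p
  r-first = All.lookup (AllPairs.head (proj₂ (proj₂ (proj₂ g))))

  up : Any (IsAbove r) (r ∷ B ++ V)
  up = proj₁ (All.head (proj₁ g))

  right : Any (IsRight r) (r ∷ B ++ V)
  right = proj₂ (All.head (proj₁ g))

  r-fresh : r ∉ B ++ V
  r-fresh i with ∈-++⁻ B i
  ... | inj₁ j = <ₚ-asym (r-first j) (r-first j)
  ... | inj₂ j with q , q∈ , b ← find up = proj₁ (term j q∈) b

  none-below : ∀ {q} → q ∈ B ++ V → ¬ IsAbove q r
  none-below i b with ∈-++⁻ B i
  ... | inj₁ j = <ₚ-asym (r-first j) (above⇒<ₚ b)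
  ... | inj₂ j = proj₁ (term j (here refl)) b

  none-left : ∀ {q} → q ∈ B ++ V → ¬ IsRight q r
  none-left i b with ∈-++⁻ B i
  ... | inj₁ j = <ₚ-asym (r-first j) (right⇒<ₚ b)
  ... | inj₂ j = proj₂ (term j (here refl)) b

  column-above : ∀ {q} → q ∈ B ++ V → x q ≡ x r → IsAbove r q
  column-above {q} i e with <-cmp (y q) (y r)
  ... | tri< lt _ _ = contradiction (sym e , lt) (none-below i)
  ... | tri≈ _ f _  = contradiction (subst (_∈ B ++ V) (cong₂ _,_ e f) i) r-fresh
  ... | tri> _ _ gt = e , gt

  row-right : ∀ {q} → q ∈ B ++ V → y q ≡ y r → IsRight r q
  row-right {q} i e with <-cmp (x q) (x r)
  ... | tri< lt _ _ = contradiction (sym e , lt) (none-left i)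
  ... | tri≈ _ f _  = contradiction (subst (_∈ B ++ V) (cong₂ _,_ f e) i) r-fresh
  ... | tri> _ _ gt = e , gt

  column-tree : ∃[ t ] (t ∈ trees × mx t ≡ x r)
  column-tree with find up
  ... | c , here refl , _ , lt = contradiction lt (<-irrefl refl)
  ... | c , there c∈ , e , _ with t , t∈ , i ← find (covers c∈)
    with left-of-column t (All.lookup valid t∈) i
  ...   | inj₁ f = t , t∈ , ≡-trans (sym f) e
  -- `p` would have `r` below it and `q` to its left.
  ...   | inj₂ (p , q , p∈ , f , q∈ , f′ , lt) =
    contradiction (column-above p∈A (≡-trans f e) , sym f′ , lt) (na p∈A (here refl) (there (sound (lose t∈ q∈))))
    where p∈A = sound (lose t∈ p∈)

  row-tree : ∃[ t ] (t ∈ trees × my t ≡ y r)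
  row-tree with find right
  ... | c , here refl , _ , lt = contradiction lt (<-irrefl refl)
  ... | c , there c∈ , e , _ with t , t∈ , i ← find (covers c∈)
    with below-row t (All.lookup valid t∈) i
  ...   | inj₁ f = t , t∈ , ≡-trans (sym f) e
  ...   | inj₂ (p , q , p∈ , f , q∈ , f′ , lt) =
    contradiction ((sym f′ , lt) , row-right p∈A (≡-trans f e)) (na p∈A (there (sound (lose t∈ q∈))) (here refl))
    where p∈A = sound (lose t∈ p∈)

  two-trees : ∃[ l ] ∃[ t ] ∃[ ts ] (trees ↭ l ∷ t ∷ ts × mx l ≡ x r × my t ≡ y r)
  two-trees with l , l∈ , el ← column-tree | t , t∈ , et ← row-tree
    with ts , σ ← ∈⇒↭∷ l∈
    with ∈-resp-↭ σ t∈
  -- If one tree led both the column and the row, its root would be `r` itself.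
  ... | here refl = contradiction (subst (_∈ B ++ V) (cong₂ _,_ el et) (sound (lose l∈ (root∈ l)))) r-fresh
  ... | there t∈′ with ts′ , τ ← ∈⇒↭∷ t∈′ = l , t , ts′ , ↭-trans σ (prep l τ) , el , et

  step : Grown V (r ∷ B ++ V)
  step with l , t , ts , σ , el , et ← two-trees
    with vl ∷ vt ∷ vs ← All-resp-↭ σ valid = record
    { trees  = node l t ∷ ts
    ; valid  = (vl , vt
               , subst (_< mx t) (sym el) (proj₂ (row-right (snd (there (here (root∈ t)))) et))
               , subst (_< my l) (sym et) (proj₂ (column-above (snd (here (root∈ l))) el))) ∷ vs
    ; leaves = ↭-trans (↭-reflexive (List.++-assoc (treeLeaves l) _ _))
                 (↭-trans (forestLeaves-↭ (↭-sym σ)) leaves)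
    ; sound  = snd′
    ; covers = λ { (here refl) → here (here (cong₂ _,_ (sym el) (sym et)))
                 ; (there i)   → cov′ (Any-resp-↭ σ (covers i)) }
    }
    where
    snd : ∀ {p} → p ∈ᶠ l ∷ t ∷ ts → p ∈ B ++ V
    snd i = sound (Any-resp-↭ (↭-sym σ) i)
    snd′ : ∀ {p} → p ∈ᶠ node l t ∷ ts → p ∈ r ∷ B ++ V
    snd′ (there i) = there (snd (there (there i)))
    snd′ (here i) with pts-node⁻ l t i
    ... | at-root refl = here (cong₂ _,_ el et)
    ... | in-left j    = there (snd (here j))
    ... | in-right j   = there (snd (there (here j)))
    cov′ : ∀ {p} → p ∈ᶠ l ∷ t ∷ ts → p ∈ᶠ node l t ∷ ts
    cov′ (here i)          = here (pts-left l t i)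
    cov′ (there (here i))  = here (pts-right l t i)
    cov′ (there (there i)) = there i

grow : ∀ V B → Growable V B → Grown V (B ++ V)
grow V []      _ = seedlings V
grow V (r ∷ B) g = GrowStep.step g (grow V B (Growable-tail g))

-- Branching points of complete forests

argmin : ∀ (f : Point → ℕ) {P : Point → Set} → (∀ p → Dec (P p)) → ∀ ps →
         All (¬_ ∘ P) ps ⊎ ∃[ c ] (c ∈ ps × P c × (∀ {q} → q ∈ ps → P q → f c ≤ f q))
argmin f P? [] = inj₁ []
argmin f P? (p ∷ ps) with P? p | argmin f P? ps
... | no ¬Pp | inj₁ ns = inj₁ (¬Pp ∷ ns)
... | no ¬Pp | inj₂ (c , c∈ , Pc , m) =
      inj₂ (c , there c∈ , Pc , λ { (here refl) Pq → contradiction Pq ¬Pp ; (there i) Pq → m i Pq })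
... | yes Pp | inj₁ ns =
      inj₂ (p , here refl , Pp , λ { (here refl) _ → ≤-refl ; (there i) Pq → contradiction Pq (All.lookup ns i) })
... | yes Pp | inj₂ (c , c∈ , Pc , m) with f p ≤? f c
...   | yes le = inj₂ (p , here refl , Pp , λ { (here refl) _ → ≤-refl ; (there i) Pq → ≤-trans le (m i Pq) })
...   | no ≰   = inj₂ (c , there c∈ , Pc , λ { (here refl) _ → ≰⇒≥ ≰ ; (there i) Pq → m i Pq })

module _ {A : List Point} where

  nextUp-exists : ∀ {p q} → q ∈ A → IsAbove p q → ∃[ c ] NextUp A p c
  nextUp-exists {p} q∈ b with argmin y (isAbove? p) A
  ... | inj₁ ns = contradiction b (All.lookup ns q∈)
  ... | inj₂ (c , c∈ , (e , lt) , m) = c , c∈ , e , lt , λ i e′ lt′ → m i (e′ , lt′)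

  nextRight-exists : ∀ {p q} → q ∈ A → IsRight p q → ∃[ c ] NextRight A p c
  nextRight-exists {p} q∈ b with argmin x (isRight? p) A
  ... | inj₁ ns = contradiction b (All.lookup ns q∈)
  ... | inj₂ (c , c∈ , (e , lt) , m) = c , c∈ , e , lt , λ i e′ lt′ → m i (e′ , lt′)

  leaf⇒terminal : NonAmbiguous A → ∀ {v} → IsLeaf A v → ∀ {p} → p ∈ A → ¬ IsAbove v p × ¬ IsRight v p
  leaf⇒terminal na (v∈ , childless) p∈ =
      (λ b → let c , n = nextUp-exists p∈ b in childless c (proj₁ n) (NextUp⇒IsParent A v∈ n))
    , (λ b → let c , n = nextRight-exists p∈ b in childless c (proj₁ n) (NextRight⇒IsParent A na v∈ n))

  -- Each direction offers at most one child, so of two distinct children one is above and the other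
  -- to the right.
  branching : Complete A → ∀ {p} → p ∈ A → ¬ IsLeaf A p →
              Any (IsAbove p) A × Any (IsRight p) A
  branching com p∈ ¬leaf with com _ p∈
  ... | inj₁ childless = contradiction (p∈ , childless) ¬leaf
  ... | inj₂ (c , c′ , c∈ , par , c′∈ , par′ , c≢c′ , _) with IsParent⁻ A c∈ par | IsParent⁻ A c′∈ par′
  ...   | inj₁ n | inj₁ n′ = contradiction (NextUp-unique A n n′) c≢c′
  ...   | inj₂ n | inj₂ n′ = contradiction (NextRight-unique A n n′) c≢c′
  ...   | inj₁ (_ , e , lt , _) | inj₂ (_ , e′ , lt′ , _) = lose c∈ (e , lt) , lose c′∈ (e′ , lt′)
  ...   | inj₂ (_ , e , lt , _) | inj₁ (_ , e′ , lt′ , _) = lose c′∈ (e′ , lt′) , lose c∈ (e , lt)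

branchPts : List Point → List Point → List Point
branchPts V = filter (λ p → nonmember? _≟ₚ_ p V)

module _ {A V : List Point} (leaves : ∀ p → IsLeaf A p ⇔ p ∈ V) where

  open module LeafEq p = Equivalence (leaves p) using (to; from)

  branch++leaf⁺ : ∀ {p} → p ∈ A → p ∈ branchPts V A ++ V
  branch++leaf⁺ {p} i with member? _≟ₚ_ p V
  ... | yes j = ∈-++⁺ʳ (branchPts V A) j
  ... | no ¬j = ∈-++⁺ˡ (∈-filter⁺ (λ p → nonmember? _≟ₚ_ p V) i ¬j)

  branch++leaf⁻ : ∀ {p} → p ∈ branchPts V A ++ V → p ∈ A
  branch++leaf⁻ {p} i with ∈-++⁻ (branchPts V A) i
  ... | inj₁ j = proj₁ (∈-filter⁻ (λ p → nonmember? _≟ₚ_ p V) j)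
  ... | inj₂ j = proj₁ (from p j)

  forest-growable : Linked _<ₚ_ A → NonAmbiguous A → Complete A → Growable V (branchPts V A)
  forest-growable srt na com =
      All.tabulate (λ {p} i →
        let p∈ , p∉ = ∈-filter⁻ (λ p → nonmember? _≟ₚ_ p V) i
            u , w = branching com p∈ (p∉ ∘ to p)
        in widen u , widen w)
    , All.tabulate (λ {v} i → All.tabulate λ j → leaf⇒terminal na (from v i) (branch++leaf⁻ j))
    , All.tabulate (λ {p} i → All.tabulate λ {q} j → All.tabulate λ {s} k (b , b′) →
        na (p , branch++leaf⁻ i , q , (branch++leaf⁻ j , sym (proj₁ b) , proj₂ b)
             , s , (branch++leaf⁻ k , sym (proj₁ b′) , proj₂ b′)))
    , AllPairs.filter⁺ (λ p → nonmember? _≟ₚ_ p V) (Linked⇒AllPairs <ₚ-trans srt)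
    where
    widen : ∀ {P : Point → Set} → Any P A → Any P (branchPts V A ++ V)
    widen i with q , q∈ , Pq ← find i = lose (branch++leaf⁺ q∈) Pq

-- Permutations and their graphs

module _ {B C : Set} where

  map-proj₁-zip : ∀ (bs : List B) (cs : List C) → length bs ≡ length cs → map proj₁ (zip bs cs) ≡ bs
  map-proj₁-zip []       []       _ = refl
  map-proj₁-zip (b ∷ bs) (c ∷ cs) e = cong (b ∷_) (map-proj₁-zip bs cs (suc-injective e))

  map-proj₂-zip : ∀ (bs : List B) (cs : List C) → length bs ≡ length cs → map proj₂ (zip bs cs) ≡ cs
  map-proj₂-zip []       []       _ = refl
  map-proj₂-zip (b ∷ bs) (c ∷ cs) e = cong (c ∷_) (map-proj₂-zip bs cs (suc-injective e))

  zip-map-proj : ∀ (ps : List (B × C)) → zip (map proj₁ ps) (map proj₂ ps) ≡ ps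
  zip-map-proj []       = refl
  zip-map-proj (p ∷ ps) = cong (p ∷_) (zip-map-proj ps)

module _ {n : ℕ} where

  length-interval : length (map suc (upTo n)) ≡ n
  length-interval = ≡-trans (List.length-map suc (upTo n)) (List.length-upTo n)

  perm-unique : ∀ {cs} → cs ↭ map suc (upTo n) → Unique cs
  perm-unique σ = AllPairs-resp-↭ ≢-sym (↭-sym σ) (Unique.map⁺ suc-injective (Unique.upTo⁺ n))

  separated : ∀ {ps} → map x ps ↭ map suc (upTo n) → map y ps ↭ map suc (upTo n) → Separated ps
  separated σ τ = AllPairs.zip (AllPairs.map⁻ (perm-unique σ) , AllPairs.map⁻ (perm-unique τ))

  module Coordinate (f : Point → ℕ) {ps : List Point} (σ : map f ps ↭ map suc (upTo n)) where

    bounds : ∀ {p} → p ∈ ps → 1 ≤ f p × f p ≤ n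
    bounds i with k , k∈ , e ← ∈-map⁻ suc (∈-resp-↭ σ (∈-map⁺ f i)) rewrite e = s≤s z≤n , ∈-upTo⁻ k∈

    attained : ∀ k → 1 ≤ k → k ≤ n → ∃[ p ] (p ∈ ps × f p ≡ k)
    attained (suc k) _ k<n with p , p∈ , e ← ∈-map⁻ f (∈-resp-↭ (↭-sym σ) (∈-map⁺ suc (∈-upTo⁺ k<n))) =
      p , p∈ , sym e

  module _ (α β : Vec ℕ n) where

    map-x-pairPts : map x (pairPts n α β) ≡ toList α
    map-x-pairPts = map-proj₁-zip (toList α) (toList β) (≡-trans (Vec.length-toList α) (sym (Vec.length-toList β)))

    map-y-pairPts : map y (pairPts n α β) ≡ toList β
    map-y-pairPts = map-proj₂-zip (toList α) (toList β) (≡-trans (Vec.length-toList α) (sym (Vec.length-toList β)))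

NoCommonRise : ∀ {n} → Vec ℕ n → Vec ℕ n → Set
NoCommonRise {n} α β = ∀ (i j : Fin n) → toℕ j ≡ suc (toℕ i) →
  ¬ (lookup α i < lookup α j × lookup β i < lookup β j)

noCommonRise⁺ : ∀ {n} (α β : Vec ℕ n) → Linked NoRise (pairPts n α β) → NoCommonRise α β
noCommonRise⁺ (a ∷ a′ ∷ α) (b ∷ b′ ∷ β) (r ∷ l) 0F       (sucF 0F) _ = r
noCommonRise⁺ (a ∷ a′ ∷ α) (b ∷ b′ ∷ β) (r ∷ l) (sucF i) (sucF j)  e = noCommonRise⁺ (a′ ∷ α) (b′ ∷ β) l i j (suc-injective e)

noCommonRise⁻ : ∀ {n} (α β : Vec ℕ n) → NoCommonRise α β → Linked NoRise (pairPts n α β)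
noCommonRise⁻ []           []           _ = []
noCommonRise⁻ (a ∷ [])     (b ∷ [])     _ = [-]
noCommonRise⁻ (a ∷ a′ ∷ α) (b ∷ b′ ∷ β) f =
  f 0F (sucF 0F) refl ∷ noCommonRise⁻ (a′ ∷ α) (b′ ∷ β) λ i j e → f (sucF i) (sucF j) (cong suc e)

-- The length proof is irrelevant because it will come from the irrelevant field `leaves` of a
-- `Forest`.
toVec : ∀ {n} (as : List ℕ) → .(length as ≡ n) → Vec ℕ n
toVec as e = cast e (fromList as)

toList-toVec : ∀ {n} as .(e : length as ≡ n) → toList (toVec as e) ≡ as
toList-toVec as e = ≡-trans (Vec.toList-cast e (fromList as)) (Vec.toList∘fromList as)

-- The middle term of the bijection. Listing the trees by increasing `mx` makes the list canonical
-- for the set of trees, and irrelevant proofs reduce equality to that of the lists.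
record Forest (n : ℕ) (η : Vec ℕ n) : Set where
  field
    trees       : List Tree
    .valid      : All Valid trees
    .increasing : AllPairs _≺_ trees
    .leaves     : forestLeaves trees ↭ graphPts n η

module _ {n : ℕ} {η : Vec ℕ n} where

  forest-≡ : {F G : Forest n η} → Forest.trees F ≡ Forest.trees G → F ≡ G
  forest-≡ refl = refl

  cforest-≡ : {F G : CForest n η} → CForest.pts F ≡ CForest.pts G → F ≡ G
  cforest-≡ refl = refl

  permPair-≡ : {P Q : PermPair n η} → PermPair.α P ≡ PermPair.α Q → PermPair.β P ≡ PermPair.β Q → P ≡ Q
  permPair-≡ refl refl = refl

module ForestBijections {n : ℕ} {η : Vec ℕ n} (ηPerm : IsPerm n η) where

  V : List Point
  V = graphPts n η

  lengths : length (map suc (upTo n)) ≡ length (toList η)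
  lengths = ≡-trans (length-interval {n}) (sym (Vec.length-toList η))

  V-x : map x V ↭ map suc (upTo n)
  V-x = ↭-reflexive (map-proj₁-zip _ (toList η) lengths)

  V-y : map y V ↭ map suc (upTo n)
  V-y = ↭-trans (↭-reflexive (map-proj₂-zip (map suc (upTo n)) (toList η) lengths)) ηPerm

  V-separated : Separated V
  V-separated = separated V-x V-y

  leaves-separated : ∀ ts → forestLeaves ts ↭ V → Separated (forestLeaves ts)
  leaves-separated ts σ = AllPairs-resp-↭ Apart-sym (↭-sym σ) V-separated

  -- The bijection from sets of trees to pairs of permutations.

  module WordOf (ts : List Tree) (σ : forestLeaves ts ↭ V) where

    word↭V : word ts ↭ V
    word↭V = ↭-trans (word-↭ ts) σ

    word-x : map x (word ts) ↭ map suc (upTo n)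
    word-x = ↭-trans (↭-map⁺ x word↭V) V-x

    word-y : map y (word ts) ↭ map suc (upTo n)
    word-y = ↭-trans (↭-map⁺ y word↭V) V-y

    length-x : length (map x (word ts)) ≡ n
    length-x = ≡-trans (↭-length word-x) (length-interval {n})

    length-y : length (map y (word ts)) ≡ n
    length-y = ≡-trans (↭-length word-y) (length-interval {n})

  module _ (ts : List Tree) .(σ : forestLeaves ts ↭ V) where

    wordα wordβ : Vec ℕ n
    wordα = toVec (map x (word ts)) (WordOf.length-x ts σ)
    wordβ = toVec (map y (word ts)) (WordOf.length-y ts σ)

    toList-wordα : toList wordα ≡ map x (word ts)
    toList-wordα = toList-toVec (map x (word ts)) (WordOf.length-x ts σ)

    toList-wordβ : toList wordβ ≡ map y (word ts)
    toList-wordβ = toList-toVec (map y (word ts)) (WordOf.length-y ts σ)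

    pairPts-word : pairPts n wordα wordβ ≡ word ts
    pairPts-word = ≡-trans (cong₂ zip toList-wordα toList-wordβ) (zip-map-proj (word ts))

  toPermPair : Forest n η → PermPair n η
  toPermPair record { trees = ts ; valid = vs ; increasing = inc ; leaves = σ } = record
    { α            = wordα ts σ
    ; β            = wordβ ts σ
    ; αPerm        = ↭-trans (↭-reflexive (toList-wordα ts σ)) (WordOf.word-x ts σ)
    ; βPerm        = ↭-trans (↭-reflexive (toList-wordβ ts σ)) (WordOf.word-y ts σ)
    ; noCommonRise = noCommonRise⁺ (wordα ts σ) (wordβ ts σ)
                       (subst (Linked NoRise) (sym (pairPts-word ts σ)) (word-noRise vs inc))
    ; pointSet     = λ p → mk⇔
        (λ i → ∈-resp-↭ (WordOf.word↭V ts σ) (subst (p ∈_) (pairPts-word ts σ) i))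
        (λ i → subst (p ∈_) (sym (pairPts-word ts σ)) (∈-resp-↭ (↭-sym (WordOf.word↭V ts σ)) i))
    }

  toPermPair-injective : ∀ {F G} → toPermPair F ≡ toPermPair G → F ≡ G
  toPermPair-injective
    {record { trees = ts ; valid = vs ; increasing = inc ; leaves = σ }}
    {record { trees = ts′ ; valid = vs′ ; increasing = inc′ ; leaves = σ′ }} eq =
    -- The fields used are irrelevant; decidable equality of trees turns the resulting equation into
    -- a relevant one.
    forest-≡ (recompute (List.≡-dec _≟ₜ_ _ _) (word-injective vs inc vs′ inc′ words-≡))
    where
    words-≡ : word ts ≡ word ts′
    words-≡ = ≡-trans (sym (pairPts-word ts σ))
      (≡-trans (cong (λ P → pairPts n (PermPair.α P) (PermPair.β P)) eq) (pairPts-word ts′ σ′))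

  noRise? : Decidable NoRise
  noRise? p q = ¬? ((x p <? x q) ×-dec (y p <? y q))

  apart? : Decidable Apart
  apart? p q = ¬? (x p ≟ x q) ×-dec ¬? (y p ≟ y q)

  pairPts-separated : ∀ (α β : Vec ℕ n) → IsPerm n α → IsPerm n β → Separated (pairPts n α β)
  pairPts-separated α β αPerm βPerm =
    separated (↭-trans (↭-reflexive (map-x-pairPts α β)) αPerm) (↭-trans (↭-reflexive (map-y-pairPts α β)) βPerm)

  -- Both lists are free of duplicates, so having the same members makes them equal as multisets.
  separated-↭V : ∀ {ps} → Separated ps → (∀ p → p ∈ ps ⇔ p ∈ V) → ps ↭ V
  separated-↭V sep same = ∼bag⇒↭ (unique∧set⇒bag (uniq sep) (uniq V-separated) (λ {p} → same p))
    where
    uniq : ∀ {ps} → Separated ps → Unique ps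
    uniq = AllPairs.map λ ap p≡q → proj₁ ap (cong x p≡q)

  toPermPair-surjective : ∀ P → ∃[ F ] toPermPair F ≡ P
  toPermPair-surjective record { α = α ; β = β ; αPerm = αPerm ; βPerm = βPerm
                               ; noCommonRise = noCommonRise ; pointSet = pointSet }
    -- `parse` returns trees, which are data, so its hypotheses must be relevant. Both are decidable
    -- and can be recomputed.
    with sep ← recompute (allPairs? apart? (pairPts n α β)) (pairPts-separated α β αPerm βPerm)
    with ts , vs , inc , e ← parse _ (pairPts n α β) ≤-refl
           (recompute (linked? noRise? (pairPts n α β)) (noCommonRise⁻ α β noCommonRise)) sep =
    record { trees = ts ; valid = vs ; increasing = inc ; leaves = leaves (separated-↭V sep pointSet) }
    , permPair-≡
        (vec-≡ (≡-trans (toList-wordα ts (leaves (separated-↭V sep pointSet)))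
          (≡-trans (cong (map x) e) (map-x-pairPts α β))))
        (vec-≡ (≡-trans (toList-wordβ ts (leaves (separated-↭V sep pointSet)))
          (≡-trans (cong (map y) e) (map-y-pairPts α β))))
    where
    leaves : pairPts n α β ↭ V → forestLeaves ts ↭ V
    leaves σ = ↭-trans (↭-sym (word-↭ ts)) (↭-trans (↭-reflexive e) σ)
    vec-≡ : ∀ {v w : Vec ℕ n} → toList v ≡ toList w → v ≡ w
    vec-≡ {v} {w} eq = ≡-trans (sym (Vec.cast-is-id refl v)) (Vec.toList-injective refl v w eq)

  -- The bijection from sets of trees to complete non-ambiguous forests.

  open InsertionSort _<ₚ?_ <ₚ-trans using () renaming (sort to sortₚ; sort-↭ to sortₚ-↭; sort-sorted to sortₚ-sorted)

  -- `deduplicate` supplies the distinctness needed for strict sorting, without an argument that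
  -- branching points do not coincide.
  drawing : List Tree → List Point
  drawing ts = sortₚ (deduplicate _≟ₚ_ (concatMap treePts ts))

  drawing-sorted : ∀ ts → AllPairs _<ₚ_ (drawing ts)
  drawing-sorted ts = sortₚ-sorted (AllPairs.map ≢⇒<ₚ⊎>ₚ (deduplicate-! _≟ₚ_ (concatMap treePts ts)))

  drawing⁻ : ∀ ts {p} → p ∈ drawing ts → p ∈ᶠ ts
  drawing⁻ ts i = ∈-concatMap⁻ treePts (∈-deduplicate⁻ _≟ₚ_ (concatMap treePts ts) (∈-resp-↭ (sortₚ-↭ _) i))

  drawing⁺ : ∀ ts {p} → p ∈ᶠ ts → p ∈ drawing ts
  drawing⁺ ts i = ∈-resp-↭ (↭-sym (sortₚ-↭ _)) (∈-deduplicate⁺ _≟ₚ_ (∈-concatMap⁺ treePts i))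

  module DrawingOf {ts} (vs : All Valid ts) (σ : forestLeaves ts ↭ V) where

    open Drawing {A = drawing ts} vs (leaves-separated ts σ) (drawing⁻ ts) (drawing⁺ ts) public

    leaf⇒A : ∀ {v} → v ∈ V → v ∈ drawing ts
    leaf⇒A i = leaf∈ (∈-resp-↭ (↭-sym σ) i)

    x-leaf : ∀ {p} → p ∈ drawing ts → ∃[ v ] (v ∈ V × x v ≡ x p)
    x-leaf i with t , t∈ , j ← find (drawing⁻ ts i) with v , v∈ , e ← pts-x t j =
      v , ∈-resp-↭ σ (∈-concatMap⁺ treeLeaves (lose t∈ v∈)) , e

    y-leaf : ∀ {p} → p ∈ drawing ts → ∃[ v ] (v ∈ V × y v ≡ y p)
    y-leaf i with t , t∈ , j ← find (drawing⁻ ts i) with v , v∈ , e ← pts-y t j =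
      v , ∈-resp-↭ σ (∈-concatMap⁺ treeLeaves (lose t∈ v∈)) , e

    module X = Coordinate x V-x
    module Y = Coordinate y V-y

    positive : PositiveCoords (drawing ts)
    positive p i with v , v∈ , e ← x-leaf i | w , w∈ , f ← y-leaf i =
      subst (1 ≤_) e (proj₁ (X.bounds v∈)) , subst (1 ≤_) f (proj₁ (Y.bounds w∈))

    -- Every coordinate is that of a leaf, hence at most `n`, and the leaves attain all values from
    -- 1 to `n`.
    noGaps : NoGaps (drawing ts)
    noGaps p i with v , v∈ , e ← x-leaf i | w , w∈ , f ← y-leaf i =
        (λ k 1≤k k<p → let q , q∈ , g = X.attained k 1≤k (≤-trans (<⇒≤ k<p) (subst (_≤ n) e (proj₂ (X.bounds v∈))))
                       in q , leaf⇒A q∈ , g)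
      , (λ k 1≤k k<p → let q , q∈ , g = Y.attained k 1≤k (≤-trans (<⇒≤ k<p) (subst (_≤ n) f (proj₂ (Y.bounds w∈))))
                       in q , leaf⇒A q∈ , g)

    leaves⇔ : ∀ p → IsLeaf (drawing ts) p ⇔ p ∈ V
    leaves⇔ p = mk⇔ (∈-resp-↭ σ ∘ Equivalence.to (isLeaf⇔ p)) (Equivalence.from (isLeaf⇔ p) ∘ ∈-resp-↭ (↭-sym σ))

  toCForest : Forest n η → CForest n η
  toCForest record { trees = trees ; valid = valid ; leaves = leaves } = record
    { pts      = drawing trees
    ; sorted   = AllPairs⇒Linked (drawing-sorted trees)
    ; positive = DrawingOf.positive valid leaves
    ; noGaps   = DrawingOf.noGaps valid leaves
    ; nonAmb   = DrawingOf.nonAmbiguous valid leaves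
    ; complete = DrawingOf.isComplete valid leaves
    ; leaves   = DrawingOf.leaves⇔ valid leaves
    }

  drawing-injective : ∀ {ts ts′} → All Valid ts → AllPairs _≺_ ts → forestLeaves ts ↭ V →
                      All Valid ts′ → AllPairs _≺_ ts′ → forestLeaves ts′ ↭ V →
                      drawing ts ≡ drawing ts′ → ts ≡ ts′
  drawing-injective {ts} {ts′} vs inc σ vs′ inc′ σ′ eq =
    strictlySorted-unique <-asym inc inc′
      (forest-⊆ vs sep vs′ sep′ (drawing⁻ ts) (drawing⁺ ts) A⊆ ⊆A)
      (forest-⊆ vs′ sep′ vs sep A⊆ ⊆A (drawing⁻ ts) (drawing⁺ ts))
    where
    sep = leaves-separated ts σ
    sep′ = leaves-separated ts′ σ′
    A⊆ : ∀ {p} → p ∈ drawing ts → p ∈ᶠ ts′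
    A⊆ {p} i = drawing⁻ ts′ (subst (p ∈_) eq i)
    ⊆A : ∀ {p} → p ∈ᶠ ts′ → p ∈ drawing ts
    ⊆A {p} i = subst (p ∈_) (sym eq) (drawing⁺ ts′ i)

  toCForest-injective : ∀ {F G} → toCForest F ≡ toCForest G → F ≡ G
  toCForest-injective
    {record { trees = ts ; valid = vs ; increasing = inc ; leaves = σ }}
    {record { trees = ts′ ; valid = vs′ ; increasing = inc′ ; leaves = σ′ }} eq =
    forest-≡ (recompute (List.≡-dec _≟ₜ_ _ _)
      (drawing-injective vs inc σ vs′ inc′ σ′ (cong CForest.pts eq)))

  open InsertionSort {R = _≺_} (λ s t → mx s <? mx t) <-trans using (Comparable)
    renaming (sort to sortₜ; sort-↭ to sortₜ-↭; sort-sorted to sortₜ-sorted)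

  -- Equal `mx` would put leaves of two different trees into one column.
  trees-comparable : ∀ ts → Separated (forestLeaves ts) → AllPairs Comparable ts
  trees-comparable []       _   = []
  trees-comparable (t ∷ ts) sep =
    All.tabulate (λ {t′} t′∈ → compare t′ t′∈) ∷ trees-comparable ts (proj₁ (proj₂ parts))
    where
    parts = AllPairs-++⁻ (treeLeaves t) sep
    compare : ∀ t′ → t′ ∈ ts → Comparable t t′
    compare t′ t′∈ with <-cmp (mx t) (mx t′)
    ... | tri< lt _ _ = inj₁ lt
    ... | tri> _ _ gt = inj₂ gt
    ... | tri≈ _ e _ with u , u∈ , eu ← mx-leaf t | v , v∈ , ev ← mx-leaf t′ =
      contradiction (≡-trans eu (≡-trans e (sym ev)))
        (proj₁ (All.lookup (All.lookup (proj₂ (proj₂ parts)) u∈) (∈-concatMap⁺ treeLeaves (lose t′∈ v∈))))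

  toCForest-surjective : ∀ C → ∃[ F ] toCForest F ≡ C
  toCForest-surjective record { pts = pts ; sorted = sorted ; nonAmb = nonAmb
                              ; complete = complete ; leaves = leaves } =
    F , cforest-≡ (recompute (List.≡-dec _≟ₚ_ _ _)
      (strictlySorted-unique <ₚ-asym (drawing-sorted (Forest.trees F)) (Linked⇒AllPairs <ₚ-trans sorted)
        (λ i → branch++leaf⁻ leaves (G.sound (Any-resp-↭ (sortₜ-↭ G.trees) (drawing⁻ (Forest.trees F) i))))
        (λ i → drawing⁺ (Forest.trees F) (Any-resp-↭ (↭-sym (sortₜ-↭ G.trees)) (G.covers (branch++leaf⁺ leaves i))))))
    where
    B = branchPts V pts
    -- The properties of the given forest are irrelevant, whereas the grown trees are data; the
    -- decidable `Growable` mediates between them.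
    module G = Grown (grow V B (recompute (growable? V B) (forest-growable leaves sorted nonAmb complete)))
    F : Forest n η
    F = record
      -- Growing leaves the trees in no particular order.
      { trees      = sortₜ G.trees
      ; valid      = All-resp-↭ (↭-sym (sortₜ-↭ G.trees)) G.valid
      ; increasing = sortₜ-sorted (trees-comparable G.trees (leaves-separated G.trees G.leaves))
      ; leaves     = ↭-trans (forestLeaves-↭ (sortₜ-↭ G.trees)) G.leaves
      }

  forest⤖cforest : Forest n η ⤖ CForest n η
  forest⤖cforest = mk⤖ (toCForest-injective , strictlySurjective⇒surjective toCForest-surjective)

  forest⤖permPair : Forest n η ⤖ PermPair n η
  forest⤖permPair = mk⤖ (toPermPair-injective , strictlySurjective⇒surjective toPermPair-surjective)

theorem3 : (n : ℕ) → 1 ≤ n → (η : Vec ℕ n) → IsPerm n η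
    → CForest n η ⤖ PermPair n η
theorem3 n _ η ηPerm = ⤖-trans (sym-≡ forest⤖cforest) forest⤖permPair
  where open ForestBijections ηPerm
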